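{- For a group $G$ (not necessarily finitely generated), the following are equivalent: (1) $G$ is neither generalized dicyclic, nor abelian with an element of order greater than $2$; (2) $G$ is orientation-rigid; (3) for every generating set $S$ of $G$, the pair $(G,S^{\leq 3})$ is orientation-rigid; (3') there exists a generating set $S$ of $G$ such that the pair $(G,S^{\leq 3})$ is orientation-rigid; (4) for every generating set $S$ of $G$, the triple $(G,S,S^{\leq 3})$ is strongly orientation-rigid; (4') there exists a generating set $S$ of $G$ such that the triple $(G,S,S^{\leq 3})$ is strongly orientation-rigid.
   Context: Generating sets never contain the identity $1_G$. For a generating set $S$, $S^{\pm}=S\cup S^{ -1}$, and $S^{\leq n}$ is the set of non-trivial elements of $G$ that are products of at most $n$ elements of $S^{\pm}$. $\mathrm{Cay}(G,S)$ is the simple undirected graph with vertex set $G$ and edge set $\{(g,h)\mid g^{ -1}h\in S^\pm\}$. The ball $\mathrm{Ball}_{\mathrm{Cay}(G,S)}(1_G)$ is the induced subgraph on $\{1_G\}\cup S^\pm$. $\mathrm{Aut}(\mathrm{Cay}_{\mathrm{col}}(G,S))$ is the group of colour-preserving automorphisms: permutations $\varphi$ of $G$ with $\varphi(gs)\in\{\varphi(g)s,\varphi(g)s^{ -1}\}$ for all $g\in G$, $s\in S^\pm$. If $B$ is a subgraph of $\mathrm{Cay}(G,S)$, a colour-preserving automorphism of $B$ is a permutation $\varphi$ of the vertex set of $B$ with $\varphi(gs)\in\{\varphi(g)s,\varphi(g)s^{ -1}\}$ for all $g\in G$, $s\in S^\pm$ such that $(g,gs)$ is an edge of $B$. A pair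 $(G,S)$ is orientation-rigid if $\mathrm{Aut}(\mathrm{Cay}_{\mathrm{col}}(G,S))$ acts freely and transitively on $G$ (equivalently, consists only of the left translations). $G$ is orientation-rigid if the pair $(G,G\setminus\{1_G\})$ is orientation-rigid. For generating sets $S\subseteq T$, the triple $(G,S,T)$ is strongly orientation-rigid if every colour-preserving automorphism of $\mathrm{Ball}_{\mathrm{Cay}(G,T)}(1_G)$ fixing $1_G$ fixes $\mathrm{Ball}_{\mathrm{Cay}(G,S)}(1_G)$ pointwise. A group $G$ is generalized dicyclic if it is non-abelian and has an abelian normal subgroup $A$ of index $2$ and an element $x\notin A$ of order $4$ with $xax^{ -1}=a^{ -1}$ for every $a\in A$. "Order greater than $2$" includes infinite order. -}

module Defs where

open import Algebra.Bundles using (Group)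
import Algebra.Definitions
import Algebra.Definitions.RawMonoid
import Algebra.Properties.Group
open import Data.Fin using (Fin)
open import Data.List using (List; foldr; length)
open import Data.List.Relation.Unary.All using (All)
open import Data.Nat as ℕ using (ℕ)
open import Data.Product using (Σ; ∃-syntax; ∃!; _×_; _,_; proj₁; proj₂)
open import Data.Sum using (_⊎_; inj₁; inj₂)
open import Data.Unit.Polymorphic using (⊤; tt)
open import Function using (Inverse)
open import Level using (Level; _⊔_; suc)
open import Relation.Binary using (Rel; Setoid; _Respects_; _Respects₂_; Symmetric)
import Relation.Binary.Construct.On as On
open import Relation.Binary.PropositionalEquality using (_≡_)
open import Relation.Nullary using (¬_)
open import Relation.Unary using (Pred)

module _ {c ℓ : Level} (G : Group c ℓ) where

  open Group G
  open Algebra.Properties.Group G using (⁻¹-involutive; ⁻¹-anti-homo-∙)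
  open Algebra.Definitions.RawMonoid rawMonoid renaming (_×_ to _·_)

  record Subset (p : Level) : Set (c ⊔ ℓ ⊔ suc p) where
    field
      Member : Pred Carrier p
      resp   : Member Respects _≈_

  open Subset

  infix 4 _∈_ _∉_

  _∈_ : ∀ {p} → Carrier → Subset p → Set p
  g ∈ S = Member S g

  _∉_ : ∀ {p} → Carrier → Subset p → Set p
  g ∉ S = ¬ (g ∈ S)

  nonTrivial : Subset ℓ
  nonTrivial = record
    { Member = λ g → ¬ (g ≈ ε)
    ; resp   = λ g≈h g≉ε h≈ε → g≉ε (trans g≈h h≈ε)
    }

  infix 8 _± _^≤_

  _± : ∀ {p} → Subset p → Subset (c ⊔ ℓ ⊔ p)
  _± {p} S = record { Member = M ; resp = M-resp }
    where
    M : Pred Carrier (c ⊔ ℓ ⊔ p)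
    M g = g ∈ S ⊎ (∃[ s ] s ∈ S × g ≈ s ⁻¹)

    M-resp : M Respects _≈_
    M-resp g≈h (inj₁ g∈S)             = inj₁ (resp S g≈h g∈S)
    M-resp g≈h (inj₂ (s , s∈S , g≈s⁻¹)) = inj₂ (s , s∈S , trans (sym g≈h) g≈s⁻¹)

  product : List Carrier → Carrier
  product = foldr _∙_ ε

  _^≤_ : ∀ {p} → Subset p → ℕ → Subset (c ⊔ ℓ ⊔ p)
  _^≤_ {p} S n = record { Member = M ; resp = M-resp }
    where
    M : Pred Carrier (c ⊔ ℓ ⊔ p)
    M g = ¬ (g ≈ ε) ×
          (∃[ ws ] length ws ℕ.≤ n × All (_∈ S ±) ws × g ≈ product ws)

    M-resp : M Respects _≈_
    M-resp g≈h (g≉ε , ws , len , ws∈ , g≈) =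
      (λ h≈ε → g≉ε (trans g≈h h≈ε)) , ws , len , ws∈ , trans (sym g≈h) g≈

  record IsGeneratingSet {p} (S : Subset p) : Set (c ⊔ ℓ ⊔ p) where
    field
      ε∉S       : ε ∉ S
      generates : ∀ g → ∃[ ws ] All (_∈ S ±) ws × g ≈ product ws

  -- Undirected graphs whose vertices are elements of G.  Absence of loops is
  -- not a field: for Cayley graphs it follows from ε ∉ S.
  record Graph (v e : Level) : Set (c ⊔ ℓ ⊔ suc (v ⊔ e)) where
    field
      Vertices    : Subset v
      Edge        : Rel Carrier e
      Edge-resp   : Edge Respects₂ _≈_
      Edge-sym    : Symmetric Edge
      Edge-source : ∀ {g h} → Edge g h → g ∈ Vertices
      Edge-target : ∀ {g h} → Edge g h → h ∈ Vertices

    vertexSetoid : Setoid (c ⊔ v) ℓ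
    vertexSetoid = On.setoid {B = Σ Carrier (_∈ Vertices)} setoid proj₁

  Cay : ∀ {p} → Subset p → Graph (c ⊔ ℓ ⊔ p) (c ⊔ ℓ ⊔ p)
  Cay {p} S = record
    { Vertices    = record { Member = λ _ → ⊤ ; resp = λ _ _ → tt }
    ; Edge        = E
    ; Edge-resp   = (λ h≈h′ → resp (S ±) (∙-cong refl h≈h′))
                  , (λ g≈g′ → resp (S ±) (∙-cong (⁻¹-cong g≈g′) refl))
    ; Edge-sym    = E-sym
    ; Edge-source = λ _ → tt
    ; Edge-target = λ _ → tt
    }
    where
    E : Rel Carrier (c ⊔ ℓ ⊔ p)
    E g h = g ⁻¹ ∙ h ∈ S ±

    flip≈ : ∀ g h → h ⁻¹ ∙ g ≈ (g ⁻¹ ∙ h) ⁻¹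
    flip≈ g h = sym (trans (⁻¹-anti-homo-∙ (g ⁻¹) h) (∙-cong refl (⁻¹-involutive g)))

    E-sym : Symmetric E
    E-sym {g} {h} (inj₁ e∈S) = inj₂ (g ⁻¹ ∙ h , e∈S , flip≈ g h)
    E-sym {g} {h} (inj₂ (s , s∈S , e≈s⁻¹)) =
      inj₁ (resp S (sym (trans (flip≈ g h) (trans (⁻¹-cong e≈s⁻¹) (⁻¹-involutive s)))) s∈S)

  induced : ∀ {v e p} → Graph v e → Subset p → Graph (v ⊔ p) (v ⊔ e ⊔ p)
  induced B P = record
    { Vertices    = record
      { Member = V
      ; resp   = V-resp
      }
    ; Edge        = λ g h → V g × V h × Edge g h
    ; Edge-resp   = (λ h≈h′ (g∈ , h∈ , e) → g∈ , V-resp h≈h′ h∈ , proj₁ Edge-resp h≈h′ e)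
                  , (λ g≈g′ (g∈ , h∈ , e) → V-resp g≈g′ g∈ , h∈ , proj₂ Edge-resp g≈g′ e)
    ; Edge-sym    = λ (g∈ , h∈ , e) → h∈ , g∈ , Edge-sym e
    ; Edge-source = λ (g∈ , _ , _) → g∈
    ; Edge-target = λ (_ , h∈ , _) → h∈
    }
    where
    open Graph B

    V : Pred Carrier _
    V g = g ∈ Vertices × g ∈ P

    V-resp : V Respects _≈_
    V-resp g≈h (g∈V , g∈P) = resp Vertices g≈h g∈V , resp P g≈h g∈P

  ε∪_± : ∀ {p} → Subset p → Subset (c ⊔ ℓ ⊔ p)
  ε∪ S ± = record
    { Member = λ g → g ≈ ε ⊎ g ∈ S ±
    ; resp   = λ { g≈h (inj₁ g≈ε) → inj₁ (trans (sym g≈h) g≈ε)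
                 ; g≈h (inj₂ g∈)  → inj₂ (resp (S ±) g≈h g∈) }
    }

  ball : ∀ {p} → Subset p → Graph (c ⊔ ℓ ⊔ p) (c ⊔ ℓ ⊔ p)
  ball S = induced (Cay S) (ε∪ S ±)

  record ColourAut {p} (S : Subset p) : Set (c ⊔ ℓ ⊔ p) where
    field
      perm : Inverse setoid setoid

    open Inverse perm public using () renaming (to to φ)

    field
      colour-preserving :
        ∀ g s → s ∈ S ± → φ (g ∙ s) ≈ φ g ∙ s ⊎ φ (g ∙ s) ≈ φ g ∙ s ⁻¹

  -- B is meant to be a subgraph of Cay S.
  record SubgraphColourAut {p v e} (S : Subset p) (B : Graph v e) :
         Set (c ⊔ ℓ ⊔ p ⊔ v ⊔ e) where
    open Graph B

    field
      perm : Inverse vertexSetoid vertexSetoid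

    φ : (g : Carrier) → g ∈ Vertices → Carrier
    φ g g∈ = proj₁ (Inverse.to perm (g , g∈))

    field
      colour-preserving :
        ∀ g s → s ∈ S ± → (edge : Edge g (g ∙ s)) →
        let φg  = φ g (Edge-source edge)
            φgs = φ (g ∙ s) (Edge-target edge)
        in φgs ≈ φg ∙ s ⊎ φgs ≈ φg ∙ s ⁻¹

  record OrientationRigid {p} (S : Subset p) : Set (c ⊔ ℓ ⊔ p) where
    field
      free       : (α : ColourAut S) → let open ColourAut α in
                   ∀ g → φ g ≈ g → ∀ h → φ h ≈ h
      transitive : ∀ g h → Σ (ColourAut S) λ α → ColourAut.φ α g ≈ h

  OrientationRigidGroup : Set (c ⊔ ℓ)
  OrientationRigidGroup = OrientationRigid nonTrivial

  -- Meant for S ⊆ T; then the vertices of ball S are among those of ball T,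
  -- so the second membership hypothesis on v is automatic.
  StronglyOrientationRigid : ∀ {p q} → Subset p → Subset q → Set (c ⊔ ℓ ⊔ p ⊔ q)
  StronglyOrientationRigid S T =
    (α : SubgraphColourAut T (ball T)) → let open SubgraphColourAut α in
    (∀ ε∈ → φ ε ε∈ ≈ ε) →
    ∀ v → v ∈ Graph.Vertices (ball S) → (v∈ : v ∈ Graph.Vertices (ball T)) → φ v v∈ ≈ v

  record IsSubgroup {p} (A : Subset p) : Set (c ⊔ p) where
    field
      ε-closed  : ε ∈ A
      ∙-closed  : ∀ {a b} → a ∈ A → b ∈ A → a ∙ b ∈ A
      ⁻¹-closed : ∀ {a} → a ∈ A → a ⁻¹ ∈ A

  record IsNormalSubgroup {p} (A : Subset p) : Set (c ⊔ p) where
    field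
      isSubgroup : IsSubgroup A
      normal     : ∀ g {a} → a ∈ A → g ∙ a ∙ g ⁻¹ ∈ A

  -- G is the disjoint union of the n left cosets r i ∙ A.
  HasIndex : ∀ {p} → Subset p → ℕ → Set (c ⊔ p)
  HasIndex A n =
    Σ (Fin n → Carrier) λ r → ∀ g → ∃! _≡_ λ i → r i ⁻¹ ∙ g ∈ A

  HasOrder : Carrier → ℕ → Set ℓ
  HasOrder x n =
    0 ℕ.< n × n · x ≈ ε × (∀ m → 0 ℕ.< m → m ℕ.< n → ¬ (m · x ≈ ε))

  -- The order of x is infinite or a natural number greater than n.
  OrderGreaterThan : Carrier → ℕ → Set ℓ
  OrderGreaterThan x n = ∀ m → 0 ℕ.< m → m ℕ.≤ n → ¬ (m · x ≈ ε)

  IsAbelian : Set (c ⊔ ℓ)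
  IsAbelian = Algebra.Definitions.Commutative _≈_ _∙_

  record IsGeneralizedDicyclic : Set (suc (c ⊔ ℓ)) where
    field
      nonAbelian : ¬ IsAbelian
      A          : Subset (c ⊔ ℓ)
      A-normal   : IsNormalSubgroup A
      A-abelian  : ∀ {a b} → a ∈ A → b ∈ A → a ∙ b ≈ b ∙ a
      A-index    : HasIndex A 2
      x          : Carrier
      x∉A        : x ∉ A
      x-order    : HasOrder x 4
      inverts    : ∀ {a} → a ∈ A → x ∙ a ∙ x ⁻¹ ≈ a ⁻¹

module Submission where

-- A colour-preserving ψ with ψ 1 = 1 either fixes g or sends it to g⁻¹ ≠ g.  Comparing ψ x and ψ y
-- along the edge x⁻¹ y gives two rules: a moved x inverts a fixed y, and two moved elements
-- commute or have the same square.  With words of length at most 3 at hand, these rules force a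
-- nonabelian group with a moved generator to be generalized dicyclic.  First, the squares of the
-- moved generators all agree and have order 2.  If no product of two fixed or of two moved
-- generators is moved, then A is generated by the fixed generators and the products of two moved
-- ones.  Otherwise such a moved product is some i j with i and j inverting each other; every
-- generator commutes with i or inverts it, and A is the centraliser of i.
--
-- Conversely, inversion on an abelian group, or inversion off A on a generalized dicyclic group,
-- preserves every colour, and its fixed points form a proper subgroup.

open import Defs
open import Level as Level using (Level; _⊔_; Lift; lift)
open import Algebra.Bundles using (Group)
import Algebra.Properties.Group
open import Axiom.ExcludedMiddle using (ExcludedMiddle)
open import Data.Bool using (Bool; true; false; not)
open import Data.Fin as Fin using (Fin)
open import Data.List using (List; []; _∷_; _++_; length)
open import Data.List.Properties using (length-++)
open import Data.List.Relation.Unary.All using (All; []; _∷_)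
open import Data.List.Relation.Unary.All.Properties using (++⁺)
open import Data.Nat as ℕ using (ℕ; suc; s≤s; z≤n)
import Data.Nat.Properties as ℕ
open import Data.Product using (_×_; ∃-syntax; _,_; proj₁; proj₂)
open import Data.Sum using (_⊎_; inj₁; inj₂; [_,_]′)
open import Data.Unit.Polymorphic using (tt)
open import Data.Vec using (Vec; lookup)
open import Function.Base using (_∘_)
open import Function.Bundles using (_⇔_; mk⇔; module Inverse)
open import Relation.Binary using (_Respects_)
open import Relation.Binary.PropositionalEquality as ≡ using (_≡_; _≢_)
import Relation.Binary.Reasoning.Setoid
import Relation.Binary.Reflection
open import Relation.Nullary using (¬_; Dec; yes; no; contradiction)
open import Relation.Nullary.Decidable using (True; toWitness; decidable-stable)

-- The obstacle is the quaternion group of order 8. There a colour-preserving map can fix or invert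
-- each of `i`, `j` and `k` independently of the other two, so the moved elements need not be the
-- complement of an abelian subgroup, and `A` cannot be read off `ψ`. This is why a moved product of
-- two generators of the same kind needs its own argument.
--
-- The bound 3 comes from the comparison of `x` with `y`, which requires `x⁻¹ ∙ y` to be short: a
-- letter against a product of two letters costs length 3. In a few places a word of length 3 is
-- itself compared with an element close to it.
--
-- To serve balls and whole Cayley graphs alike, the argument concerns a map on short elements only;
-- a global automorphism that fixes `h` is first recentred at `h`.

-- Identities valid in all groups, by free reduction.

module GroupSolver {c ℓ : Level} (G : Group c ℓ) where

  open Group G
  open Algebra.Properties.Group G
  open Relation.Binary.Reasoning.Setoid setoid

  infixl 7 _⊕_
  infix 8 ⊖_

  data Expr (n : ℕ) : Set where
    var : Fin n → Expr n
    𝟏   : Expr n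
    _⊕_ : Expr n → Expr n → Expr n
    ⊖_  : Expr n → Expr n

  Word : ℕ → Set
  Word n = List (Bool × Fin n)

  signed : Bool → Carrier → Carrier
  signed true  x = x
  signed false x = x ⁻¹

  ⟦_⟧ : ∀ {n} → Expr n → Vec Carrier n → Carrier
  ⟦ var i ⟧ ρ = lookup ρ i
  ⟦ 𝟏 ⟧     ρ = ε
  ⟦ e ⊕ f ⟧ ρ = ⟦ e ⟧ ρ ∙ ⟦ f ⟧ ρ
  ⟦ ⊖ e ⟧   ρ = ⟦ e ⟧ ρ ⁻¹

  ⟦_⟧ʷ : ∀ {n} → Word n → Vec Carrier n → Carrier
  ⟦ [] ⟧ʷ          ρ = ε
  ⟦ (b , i) ∷ w ⟧ʷ ρ = signed b (lookup ρ i) ∙ ⟦ w ⟧ʷ ρ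

  -- Cancels at the junction, so a word built by successive pushes is freely reduced and can serve
  -- as a normal form.
  push : ∀ {n} → Bool → Fin n → Word n → Word n
  push b i [] = (b , i) ∷ []
  push b i ((b′ , j) ∷ w) with i Fin.≟ j
  push true  i ((false , j) ∷ w) | yes _ = w
  push false i ((true , j) ∷ w)  | yes _ = w
  push b     i ((b′ , j) ∷ w)    | _     = (b , i) ∷ (b′ , j) ∷ w

  append : ∀ {n} → Bool → Expr n → Word n → Word n
  append b     (var i) w = push b i w
  append b     𝟏       w = w
  append true  (e ⊕ f) w = append true e (append true f w)
  append false (e ⊕ f) w = append false f (append false e w)
  append b     (⊖ e)   w = append (not b) e w

  push-correct : ∀ {n} b (i : Fin n) w ρ →
                 ⟦ push b i w ⟧ʷ ρ ≈ signed b (lookup ρ i) ∙ ⟦ w ⟧ʷ ρ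
  push-correct b i [] ρ = refl
  push-correct b i ((b′ , j) ∷ w) ρ with i Fin.≟ j
  push-correct true  i ((true , j) ∷ w)  ρ | yes _      = refl
  push-correct true  i ((false , i) ∷ w) ρ | yes ≡.refl = sym (\\-leftDividesˡ (lookup ρ i) _)
  push-correct false i ((true , i) ∷ w)  ρ | yes ≡.refl = sym (\\-leftDividesʳ (lookup ρ i) _)
  push-correct false i ((false , j) ∷ w) ρ | yes _      = refl
  push-correct true  i ((b′ , j) ∷ w)    ρ | no _       = refl
  push-correct false i ((b′ , j) ∷ w)    ρ | no _       = refl

  append-correct : ∀ {n} b (e : Expr n) w ρ →
                   ⟦ append b e w ⟧ʷ ρ ≈ signed b (⟦ e ⟧ ρ) ∙ ⟦ w ⟧ʷ ρ
  append-correct b     (var i) w ρ = push-correct b i w ρ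
  append-correct true  𝟏       w ρ = sym (identityˡ _)
  append-correct false 𝟏       w ρ = sym (trans (∙-congʳ ε⁻¹≈ε) (identityˡ _))
  append-correct true  (e ⊕ f) w ρ = begin
    ⟦ append true e (append true f w) ⟧ʷ ρ ≈⟨ append-correct true e _ ρ ⟩
    ⟦ e ⟧ ρ ∙ ⟦ append true f w ⟧ʷ ρ       ≈⟨ ∙-congˡ (append-correct true f w ρ) ⟩
    ⟦ e ⟧ ρ ∙ (⟦ f ⟧ ρ ∙ ⟦ w ⟧ʷ ρ)         ≈⟨ assoc _ _ _ ⟨
    ⟦ e ⟧ ρ ∙ ⟦ f ⟧ ρ ∙ ⟦ w ⟧ʷ ρ           ∎
  append-correct false (e ⊕ f) w ρ = begin
    ⟦ append false f (append false e w) ⟧ʷ ρ ≈⟨ append-correct false f _ ρ ⟩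
    ⟦ f ⟧ ρ ⁻¹ ∙ ⟦ append false e w ⟧ʷ ρ     ≈⟨ ∙-congˡ (append-correct false e w ρ) ⟩
    ⟦ f ⟧ ρ ⁻¹ ∙ (⟦ e ⟧ ρ ⁻¹ ∙ ⟦ w ⟧ʷ ρ)     ≈⟨ assoc _ _ _ ⟨
    ⟦ f ⟧ ρ ⁻¹ ∙ ⟦ e ⟧ ρ ⁻¹ ∙ ⟦ w ⟧ʷ ρ       ≈⟨ ∙-congʳ (⁻¹-anti-homo-∙ _ _) ⟨
    (⟦ e ⟧ ρ ∙ ⟦ f ⟧ ρ) ⁻¹ ∙ ⟦ w ⟧ʷ ρ        ∎
  append-correct true  (⊖ e) w ρ = append-correct false e w ρ
  append-correct false (⊖ e) w ρ =
    trans (append-correct true e w ρ) (∙-congʳ (sym (⁻¹-involutive _)))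

  open Relation.Binary.Reflection setoid var ⟦_⟧ (λ e → ⟦ append true e [] ⟧ʷ)
    (λ e ρ → trans (append-correct true e [] ρ) (identityʳ _)) public
    using (solve; _⊜_)

-- Calculus of commuting and inverting elements.

module CommutesInverts {c ℓ : Level} (G : Group c ℓ) where

  open Group G
  open Algebra.Properties.Group G using (inverseʳ-unique)
  open GroupSolver G using (solve; _⊜_; _⊕_; ⊖_; 𝟏)
  open Relation.Binary.Reasoning.Setoid setoid

  Commutes : Carrier → Carrier → Set ℓ
  Commutes a b = a ∙ b ≈ b ∙ a

  Inverts : Carrier → Carrier → Set ℓ
  Inverts a b = a ∙ b ≈ b ⁻¹ ∙ a

  -- Many derivations multiply one known relation `x ≈ y` by `u` on the left and by `v` on the
  -- right; the two outer equations then usually hold in every group and go to the solver.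
  between : ∀ {x y} u v {l r} → l ≈ u ∙ (x ∙ v) → u ∙ (y ∙ v) ≈ r → x ≈ y → l ≈ r
  between u v l≈ ≈r x≈y = trans l≈ (trans (∙-congˡ (∙-congʳ x≈y)) ≈r)

  commutes-refl : ∀ {a} → Commutes a a
  commutes-refl = refl

  commutes-respˡ : ∀ {a a′ b} → a ≈ a′ → Commutes a b → Commutes a′ b
  commutes-respˡ e p = trans (∙-congʳ (sym e)) (trans p (∙-congˡ e))

  commutes-respʳ : ∀ {a b b′} → b ≈ b′ → Commutes a b → Commutes a b′
  commutes-respʳ e p = sym (commutes-respˡ e (sym p))

  commutes-ε : ∀ {a} → Commutes a ε
  commutes-ε = trans (identityʳ _) (sym (identityˡ _))

  commutes-∙ʳ : ∀ {a b d} → Commutes a b → Commutes a d → Commutes a (b ∙ d)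
  commutes-∙ʳ {a} {b} {d} p q = begin
    a ∙ (b ∙ d) ≈⟨ assoc _ _ _ ⟨
    a ∙ b ∙ d   ≈⟨ ∙-congʳ p ⟩
    b ∙ a ∙ d   ≈⟨ assoc _ _ _ ⟩
    b ∙ (a ∙ d) ≈⟨ ∙-congˡ q ⟩
    b ∙ (d ∙ a) ≈⟨ assoc _ _ _ ⟨
    b ∙ d ∙ a   ∎

  commutes-∙ˡ : ∀ {a b d} → Commutes a d → Commutes b d → Commutes (a ∙ b) d
  commutes-∙ˡ p q = sym (commutes-∙ʳ (sym p) (sym q))

  commutes-⁻¹ʳ : ∀ {a b} → Commutes a b → Commutes a (b ⁻¹)
  commutes-⁻¹ʳ {a} {b} p = sym (between (b ⁻¹) (b ⁻¹)
    (solve 2 (λ a b → ⊖ b ⊕ a ⊜ ⊖ b ⊕ (a ⊕ b ⊕ ⊖ b)) refl a b)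
    (solve 2 (λ a b → ⊖ b ⊕ (b ⊕ a ⊕ ⊖ b) ⊜ a ⊕ ⊖ b) refl a b) p)

  inverts-flip : ∀ {a b} → Inverts a b → a ∙ b ⁻¹ ≈ b ∙ a
  inverts-flip {a} {b} p = sym (between b (b ⁻¹)
    (solve 2 (λ a b → b ⊕ a ⊜ b ⊕ (a ⊕ b ⊕ ⊖ b)) refl a b)
    (solve 2 (λ a b → b ⊕ (⊖ b ⊕ a ⊕ ⊖ b) ⊜ a ⊕ ⊖ b) refl a b) p)

  inverts-respʳ : ∀ {a b b′} → b ≈ b′ → Inverts a b → Inverts a b′
  inverts-respʳ e p = trans (∙-congˡ (sym e)) (trans p (∙-congʳ (⁻¹-cong e)))

  inverts-ε : ∀ {a} → Inverts a ε
  inverts-ε {a} = solve 1 (λ a → a ⊕ 𝟏 ⊜ ⊖ 𝟏 ⊕ a) refl a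

  inverts-⁻¹ʳ : ∀ {a b} → Inverts a b → Inverts a (b ⁻¹)
  inverts-⁻¹ʳ {a} {b} p =
    trans (inverts-flip p) (solve 2 (λ a b → b ⊕ a ⊜ ⊖ ⊖ b ⊕ a) refl a b)

  inverts-∙ʳ : ∀ {a b d} → Inverts a b → Inverts a d → Commutes b d → Inverts a (b ∙ d)
  inverts-∙ʳ {a} {b} {d} p q r = begin
    a ∙ (b ∙ d)      ≈⟨ ∙-congˡ r ⟩
    a ∙ (d ∙ b)      ≈⟨ assoc _ _ _ ⟨
    a ∙ d ∙ b        ≈⟨ ∙-congʳ q ⟩
    d ⁻¹ ∙ a ∙ b     ≈⟨ assoc _ _ _ ⟩
    d ⁻¹ ∙ (a ∙ b)   ≈⟨ ∙-congˡ p ⟩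
    d ⁻¹ ∙ (b ⁻¹ ∙ a) ≈⟨ solve 3 (λ a b d → ⊖ d ⊕ (⊖ b ⊕ a) ⊜ ⊖ (b ⊕ d) ⊕ a) refl a b d ⟩
    (b ∙ d) ⁻¹ ∙ a   ∎

  inverts-∙ˡ : ∀ {a b d} → Inverts a d → Inverts b d → Commutes (a ∙ b) d
  inverts-∙ˡ {a} {b} {d} p q = begin
    a ∙ b ∙ d      ≈⟨ assoc _ _ _ ⟩
    a ∙ (b ∙ d)    ≈⟨ ∙-congˡ q ⟩
    a ∙ (d ⁻¹ ∙ b) ≈⟨ assoc _ _ _ ⟨
    a ∙ d ⁻¹ ∙ b   ≈⟨ ∙-congʳ (inverts-flip p) ⟩
    d ∙ a ∙ b      ≈⟨ assoc _ _ _ ⟩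
    d ∙ (a ∙ b)    ∎

  inverts∧commutes-∙ˡ : ∀ {a b d} → Inverts a d → Commutes b d → Inverts (a ∙ b) d
  inverts∧commutes-∙ˡ {a} {b} {d} p q = begin
    a ∙ b ∙ d      ≈⟨ assoc _ _ _ ⟩
    a ∙ (b ∙ d)    ≈⟨ ∙-congˡ q ⟩
    a ∙ (d ∙ b)    ≈⟨ assoc _ _ _ ⟨
    a ∙ d ∙ b      ≈⟨ ∙-congʳ p ⟩
    d ⁻¹ ∙ a ∙ b   ≈⟨ assoc _ _ _ ⟩
    d ⁻¹ ∙ (a ∙ b) ∎

  commutes∧inverts⇒involution : ∀ {a b} → Commutes a b → Inverts a b → b ∙ b ≈ ε
  commutes∧inverts⇒involution {a} {b} p q = between b (a ⁻¹)
    (solve 2 (λ a b → b ⊕ b ⊜ b ⊕ (b ⊕ a ⊕ ⊖ a)) refl a b)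
    (solve 2 (λ a b → b ⊕ (⊖ b ⊕ a ⊕ ⊖ a) ⊜ 𝟏) refl a b) (trans (sym p) q)

  involution⇒⁻¹≈ : ∀ {b} → b ∙ b ≈ ε → b ≈ b ⁻¹
  involution⇒⁻¹≈ {b} = between ε (b ⁻¹)
    (solve 1 (λ b → b ⊜ 𝟏 ⊕ (b ⊕ b ⊕ ⊖ b)) refl b)
    (solve 1 (λ b → 𝟏 ⊕ (𝟏 ⊕ ⊖ b) ⊜ ⊖ b) refl b)

  ⁻¹≈⇒involution : ∀ {b} → b ≈ b ⁻¹ → b ∙ b ≈ ε
  ⁻¹≈⇒involution e = trans (∙-congˡ e) (inverseʳ _)

  commutes∧involution⇒inverts : ∀ {a b} → Commutes a b → b ∙ b ≈ ε → Inverts a b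
  commutes∧involution⇒inverts p q = trans p (∙-congʳ (involution⇒⁻¹≈ q))

  inverts∧involution⇒commutes : ∀ {a b} → Inverts a b → b ∙ b ≈ ε → Commutes a b
  inverts∧involution⇒commutes p q = trans p (∙-congʳ (sym (involution⇒⁻¹≈ q)))

  -- Since `(a ∙ b) ⁻¹ ∙ a` is `b ⁻¹`, the hypothesis reads `a ∙ (a ∙ b) ≈ b ⁻¹`.
  inverts-own-product⇒squares : ∀ {a b} → Inverts a (a ∙ b) → (a ∙ a) ∙ (b ∙ b) ≈ ε
  inverts-own-product⇒squares {a} {b} = between ε b
    (solve 2 (λ a b → a ⊕ a ⊕ (b ⊕ b) ⊜ 𝟏 ⊕ (a ⊕ (a ⊕ b) ⊕ b)) refl a b)
    (solve 2 (λ a b → 𝟏 ⊕ (⊖ (a ⊕ b) ⊕ a ⊕ b) ⊜ 𝟏) refl a b)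

  -- The commutator of `a` and `b` is `b⁻²` by the first hypothesis and `a²` by the second.
  mutually-inverting⇒squares : ∀ {a b} → Inverts a b → Inverts b a → (a ∙ a) ∙ (b ∙ b) ≈ ε
  mutually-inverting⇒squares {a} {b} p q = begin
    (a ∙ a) ∙ (b ∙ b)       ≈⟨ solve 2 (λ a b → a ⊕ a ⊕ (b ⊕ b) ⊜ a ⊕ (a ⊕ b) ⊕ b) refl a b ⟩
    a ∙ (a ∙ b) ∙ b         ≈⟨ ∙-congʳ (∙-congˡ (sym (inverts-flip q))) ⟩
    a ∙ (b ∙ a ⁻¹) ∙ b      ≈⟨ solve 2 (λ a b → a ⊕ (b ⊕ ⊖ a) ⊕ b ⊜ a ⊕ b ⊕ (⊖ a ⊕ b)) refl a b ⟩
    a ∙ b ∙ (a ⁻¹ ∙ b)      ≈⟨ ∙-cong p (sym q) ⟩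
    b ⁻¹ ∙ a ∙ (b ∙ a)      ≈⟨ solve 2 (λ a b → ⊖ b ⊕ a ⊕ (b ⊕ a) ⊜ ⊖ b ⊕ (a ⊕ b) ⊕ a) refl a b ⟩
    b ⁻¹ ∙ (a ∙ b) ∙ a      ≈⟨ ∙-congʳ (∙-congˡ (sym (inverts-flip q))) ⟩
    b ⁻¹ ∙ (b ∙ a ⁻¹) ∙ a   ≈⟨ solve 2 (λ a b → ⊖ b ⊕ (b ⊕ ⊖ a) ⊕ a ⊜ 𝟏) refl a b ⟩
    ε                       ∎

  commutes∧squares⇒involution : ∀ {a b} → Commutes a b → (a ∙ a) ∙ (b ∙ b) ≈ ε →
                                (a ∙ b) ∙ (a ∙ b) ≈ ε
  commutes∧squares⇒involution {a} {b} p q = trans (between a b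
    (solve 2 (λ a b → a ⊕ b ⊕ (a ⊕ b) ⊜ a ⊕ (b ⊕ a ⊕ b)) refl a b)
    (solve 2 (λ a b → a ⊕ (a ⊕ b ⊕ b) ⊜ a ⊕ a ⊕ (b ⊕ b)) refl a b) (sym p)) q

  squares-swap : ∀ {a b} → (a ∙ a) ∙ (b ∙ b) ≈ ε → (b ∙ b) ∙ (a ∙ a) ≈ ε
  squares-swap {a} {b} = between ((a ∙ a) ⁻¹) (a ∙ a)
    (solve 2 (λ a b → b ⊕ b ⊕ (a ⊕ a) ⊜ ⊖ (a ⊕ a) ⊕ (a ⊕ a ⊕ (b ⊕ b) ⊕ (a ⊕ a))) refl a b)
    (solve 2 (λ a b → ⊖ (a ⊕ a) ⊕ (𝟏 ⊕ (a ⊕ a)) ⊜ 𝟏) refl a b)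

  squares⇒⁻¹⁻¹ : ∀ {a b} → (a ∙ a) ∙ (b ∙ b) ≈ ε → a ⁻¹ ∙ b ⁻¹ ≈ a ∙ b
  squares⇒⁻¹⁻¹ {a} {b} e = sym (between (a ⁻¹) (b ⁻¹)
    (solve 2 (λ a b → a ⊕ b ⊜ ⊖ a ⊕ (a ⊕ a ⊕ (b ⊕ b) ⊕ ⊖ b)) refl a b)
    (solve 2 (λ a b → ⊖ a ⊕ (𝟏 ⊕ ⊖ b) ⊜ ⊖ a ⊕ ⊖ b) refl a b) e)

  squares∧involution⇒commutes : ∀ {a b} → (a ∙ a) ∙ (b ∙ b) ≈ ε → (a ∙ b) ∙ (a ∙ b) ≈ ε →
                                Commutes a b
  squares∧involution⇒commutes {a} {b} p q = begin
    a ∙ b          ≈⟨ involution⇒⁻¹≈ q ⟩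
    (a ∙ b) ⁻¹     ≈⟨ solve 2 (λ a b → ⊖ (a ⊕ b) ⊜ ⊖ b ⊕ ⊖ a) refl a b ⟩
    b ⁻¹ ∙ a ⁻¹    ≈⟨ squares⇒⁻¹⁻¹ (squares-swap p) ⟩
    b ∙ a          ∎

  squares-trans : ∀ {a b d} → (a ∙ a) ∙ (b ∙ b) ≈ ε → (b ∙ b) ∙ (b ∙ b) ≈ ε →
                  (b ∙ b) ∙ (d ∙ d) ≈ ε → (a ∙ a) ∙ (d ∙ d) ≈ ε
  squares-trans {a} {b} {d} p q r = begin
    (a ∙ a) ∙ (d ∙ d)                         ≈⟨ solve 3 (λ a b d → a ⊕ a ⊕ (d ⊕ d) ⊜
                                                   a ⊕ a ⊕ (b ⊕ b) ⊕ ⊖ (b ⊕ b ⊕ (b ⊕ b)) ⊕ (b ⊕ b ⊕ (d ⊕ d)))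
                                                   refl a b d ⟩
    (a ∙ a) ∙ (b ∙ b) ∙ ((b ∙ b) ∙ (b ∙ b)) ⁻¹ ∙ ((b ∙ b) ∙ (d ∙ d)) ≈⟨ ∙-cong (∙-cong p (⁻¹-cong q)) r ⟩
    ε ∙ ε ⁻¹ ∙ ε                              ≈⟨ solve 0 (𝟏 ⊕ ⊖ 𝟏 ⊕ 𝟏 ⊜ 𝟏) refl ⟩
    ε                                         ∎

  commutes-⁻¹ˡ : ∀ {a b} → Commutes a b → Commutes (a ⁻¹) b
  commutes-⁻¹ˡ p = sym (commutes-⁻¹ʳ (sym p))

  commutes-cancelˡ : ∀ {a b d} → Commutes (a ∙ b) d → Commutes a d → Commutes b d
  commutes-cancelˡ {a} {b} p q = commutes-respˡ
    (solve 2 (λ a b → ⊖ a ⊕ (a ⊕ b) ⊜ b) refl a b) (commutes-∙ˡ (commutes-⁻¹ˡ q) p)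

  -- The factor `d` can be moved to the right end of both sides and cancelled, which leaves
  -- `a ∙ b ∙ a ≈ a ∙ a ∙ b`.
  commutes-common-factor : ∀ {a b d} → Commutes d a → Commutes d b →
                           Commutes (a ∙ b) (a ∙ d) → Commutes a b
  commutes-common-factor {a} {b} {d} p q r = sym (begin
    b ∙ a                         ≈⟨ solve 3 (λ a b d → b ⊕ a ⊜ ⊖ a ⊕ (a ⊕ b ⊕ (a ⊕ d)) ⊕ ⊖ d) refl a b d ⟩
    a ⁻¹ ∙ (a ∙ b ∙ (a ∙ d)) ∙ d ⁻¹ ≈⟨ ∙-congʳ (∙-congˡ r) ⟩
    a ⁻¹ ∙ (a ∙ d ∙ (a ∙ b)) ∙ d ⁻¹ ≈⟨ solve 3 (λ a b d → ⊖ a ⊕ (a ⊕ d ⊕ (a ⊕ b)) ⊕ ⊖ d ⊜ d ⊕ (a ⊕ b) ⊕ ⊖ d) refl a b d ⟩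
    d ∙ (a ∙ b) ∙ d ⁻¹            ≈⟨ ∙-congʳ (commutes-∙ʳ p q) ⟩
    a ∙ b ∙ d ∙ d ⁻¹              ≈⟨ solve 3 (λ a b d → a ⊕ b ⊕ d ⊕ ⊖ d ⊜ a ⊕ b) refl a b d ⟩
    a ∙ b                         ∎)

  -- Conjugation by `a` sends `b ∙ d` to `b ⁻¹ ∙ d ⁻¹` factor by factor, and to `d ⁻¹ ∙ b ⁻¹` as a
  -- whole.
  inverts-product⇒commutes : ∀ {a b d} → Inverts a b → Inverts a d → Inverts a (b ∙ d) → Commutes b d
  inverts-product⇒commutes {a} {b} {d} p q r = begin
    b ∙ d                        ≈⟨ solve 3 (λ a b d → b ⊕ d ⊜ a ⊕ ⊖ (⊖ (b ⊕ d) ⊕ a)) refl a b d ⟩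
    a ∙ ((b ∙ d) ⁻¹ ∙ a) ⁻¹      ≈⟨ ∙-congˡ (⁻¹-cong (sym r)) ⟩
    a ∙ (a ∙ (b ∙ d)) ⁻¹         ≈⟨ ∙-congˡ (⁻¹-cong (sym (assoc _ _ _))) ⟩
    a ∙ (a ∙ b ∙ d) ⁻¹           ≈⟨ ∙-congˡ (⁻¹-cong (∙-congʳ p)) ⟩
    a ∙ (b ⁻¹ ∙ a ∙ d) ⁻¹        ≈⟨ ∙-congˡ (⁻¹-cong (trans (assoc _ _ _) (∙-congˡ q))) ⟩
    a ∙ (b ⁻¹ ∙ (d ⁻¹ ∙ a)) ⁻¹   ≈⟨ solve 3 (λ a b d → a ⊕ ⊖ (⊖ b ⊕ (⊖ d ⊕ a)) ⊜ d ⊕ b) refl a b d ⟩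
    d ∙ b                        ∎

  product-inverts-left : ∀ {a b} → Inverts (a ∙ b) a → Inverts b a
  product-inverts-left {a} {b} = between (a ⁻¹) ε
    (solve 2 (λ a b → b ⊕ a ⊜ ⊖ a ⊕ (a ⊕ b ⊕ a ⊕ 𝟏)) refl a b)
    (solve 2 (λ a b → ⊖ a ⊕ (⊖ a ⊕ (a ⊕ b) ⊕ 𝟏) ⊜ ⊖ a ⊕ b) refl a b)

  product-inverts-right : ∀ {a b} → Inverts (a ∙ b) b → Inverts a b
  product-inverts-right {a} {b} = between ε (b ⁻¹)
    (solve 2 (λ a b → a ⊕ b ⊜ 𝟏 ⊕ (a ⊕ b ⊕ b ⊕ ⊖ b)) refl a b)
    (solve 2 (λ a b → 𝟏 ⊕ (⊖ b ⊕ (a ⊕ b) ⊕ ⊖ b) ⊜ ⊖ b ⊕ a) refl a b)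

  inverts⇒product-square : ∀ {a b} → Inverts b a → (a ∙ b) ∙ (a ∙ b) ≈ b ∙ b
  inverts⇒product-square {a} {b} = between a b
    (solve 2 (λ a b → a ⊕ b ⊕ (a ⊕ b) ⊜ a ⊕ (b ⊕ a ⊕ b)) refl a b)
    (solve 2 (λ a b → a ⊕ (⊖ a ⊕ b ⊕ b) ⊜ b ⊕ b) refl a b)

  -- The square of `b` equals `a⁻²` and so commutes with `a`, but `a` also inverts it.
  mutually-inverting⇒fourth-power : ∀ {a b} → Inverts a b → Inverts b a → (b ∙ b) ∙ (b ∙ b) ≈ ε
  mutually-inverting⇒fourth-power {a} {b} p q =
    commutes∧inverts⇒involution
      (commutes-respʳ (sym (inverseʳ-unique _ _ (mutually-inverting⇒squares p q)))
        (commutes-⁻¹ʳ (commutes-∙ʳ commutes-refl commutes-refl)))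
      (inverts-∙ʳ p p commutes-refl)

  squares-inverse⇒inverts : ∀ {a b} → (a ∙ a) ∙ (b ∙ b) ≈ ε → Inverts a b → Inverts b a
  squares-inverse⇒inverts {a} {b} e p = begin
    b ∙ a         ≈⟨ squares⇒⁻¹⁻¹ (squares-swap e) ⟨
    b ⁻¹ ∙ a ⁻¹   ≈⟨ solve 2 (λ a b → ⊖ b ⊕ ⊖ a ⊜ ⊖ (a ⊕ b)) refl a b ⟩
    (a ∙ b) ⁻¹    ≈⟨ ⁻¹-cong p ⟩
    (b ⁻¹ ∙ a) ⁻¹ ≈⟨ solve 2 (λ a b → ⊖ (⊖ b ⊕ a) ⊜ ⊖ a ⊕ b) refl a b ⟩
    a ⁻¹ ∙ b      ∎

  -- Reduces commutation of two elements of `A` outside the letters to a symmetric relation; the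
  -- three lemmas after it supply that relation, according to how `g` and `h` act on `j`.
  swap⇒commutes : ∀ {g h j} → g ∙ j ∙ h ≈ h ∙ j ∙ g → Commutes (g ∙ j) (h ∙ j)
  swap⇒commutes {g} {h} {j} e = begin
    g ∙ j ∙ (h ∙ j)  ≈⟨ assoc _ _ _ ⟨
    g ∙ j ∙ h ∙ j    ≈⟨ ∙-congʳ e ⟩
    h ∙ j ∙ g ∙ j    ≈⟨ assoc _ _ _ ⟩
    h ∙ j ∙ (g ∙ j)  ∎

  swap-inverting : ∀ {g h j} → Inverts g j → Inverts h j → Commutes g h → g ∙ j ∙ h ≈ h ∙ j ∙ g
  swap-inverting {g} {h} {j} p q r = begin
    g ∙ j ∙ h        ≈⟨ ∙-congʳ p ⟩
    j ⁻¹ ∙ g ∙ h     ≈⟨ assoc _ _ _ ⟩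
    j ⁻¹ ∙ (g ∙ h)   ≈⟨ ∙-congˡ r ⟩
    j ⁻¹ ∙ (h ∙ g)   ≈⟨ assoc _ _ _ ⟨
    j ⁻¹ ∙ h ∙ g     ≈⟨ ∙-congʳ q ⟨
    h ∙ j ∙ g        ∎

  swap-commuting : ∀ {g h j} → Commutes g j → Commutes h j → Commutes g h → g ∙ j ∙ h ≈ h ∙ j ∙ g
  swap-commuting {g} {h} {j} p q r = begin
    g ∙ j ∙ h        ≈⟨ ∙-congʳ p ⟩
    j ∙ g ∙ h        ≈⟨ assoc _ _ _ ⟩
    j ∙ (g ∙ h)      ≈⟨ ∙-congˡ r ⟩
    j ∙ (h ∙ g)      ≈⟨ assoc _ _ _ ⟨
    j ∙ h ∙ g        ≈⟨ ∙-congʳ q ⟨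
    h ∙ j ∙ g        ∎

  swap-mixed : ∀ {g h j} → Inverts g j → Commutes h j → Inverts g h → (h ∙ h) ∙ (j ∙ j) ≈ ε →
               g ∙ j ∙ h ≈ h ∙ j ∙ g
  swap-mixed {g} {h} {j} p q r e = begin
    g ∙ j ∙ h           ≈⟨ ∙-congʳ p ⟩
    j ⁻¹ ∙ g ∙ h        ≈⟨ assoc _ _ _ ⟩
    j ⁻¹ ∙ (g ∙ h)      ≈⟨ ∙-congˡ r ⟩
    j ⁻¹ ∙ (h ⁻¹ ∙ g)   ≈⟨ assoc _ _ _ ⟨
    j ⁻¹ ∙ h ⁻¹ ∙ g     ≈⟨ ∙-congʳ (squares⇒⁻¹⁻¹ (squares-swap e)) ⟩
    j ∙ h ∙ g           ≈⟨ ∙-congʳ q ⟨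
    h ∙ j ∙ g           ∎

-- Short words in the generators, and maps defined on them.

module Words {c ℓ : Level} (G : Group c ℓ) (S : Subset G (c ⊔ ℓ)) where

  open Group G
  open GroupSolver G using (solve; _⊜_; _⊕_; ⊖_; 𝟏)
  open CommutesInverts G
  open Algebra.Properties.Group G using (⁻¹-involutive; ⁻¹-anti-homo-∙)
  open Relation.Binary.Reasoning.Setoid setoid

  Letter : Carrier → Set (c ⊔ ℓ)
  Letter = Subset.Member (_± G S)

  letter-⁻¹ : ∀ {g} → Letter g → Letter (g ⁻¹)
  letter-⁻¹ {g} (inj₁ g∈S)             = inj₂ (g , g∈S , refl)
  letter-⁻¹ {g} (inj₂ (s , s∈S , g≈)) =
    inj₁ (Subset.resp S (sym (trans (⁻¹-cong g≈) (⁻¹-involutive s))) s∈S)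

  -- In contrast to `S ^≤ n`, this admits `ε`, so that lengths simply add under products.
  Short : ℕ → Carrier → Set (c ⊔ ℓ)
  Short n g = ∃[ ws ] length ws ℕ.≤ n × All Letter ws × g ≈ product G ws

  product-++ : ∀ us vs → product G (us ++ vs) ≈ product G us ∙ product G vs
  product-++ []       vs = sym (identityˡ _)
  product-++ (u ∷ us) vs = trans (∙-congˡ (product-++ us vs)) (sym (assoc _ _ _))

  short-resp : ∀ {n g h} → g ≈ h → Short n g → Short n h
  short-resp g≈h (ws , len , ws∈ , g≈) = ws , len , ws∈ , trans (sym g≈h) g≈

  short-≤ : ∀ {m n g} → m ℕ.≤ n → Short m g → Short n g
  short-≤ m≤n (ws , len , ws∈ , g≈) = ws , ℕ.≤-trans len m≤n , ws∈ , g≈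

  short-ε : ∀ {n} → Short n ε
  short-ε = [] , z≤n , [] , refl

  short-letter : ∀ {g} → Letter g → Short 1 g
  short-letter {g} l = g ∷ [] , s≤s z≤n , l ∷ [] , sym (identityʳ g)

  short-∙ : ∀ {m n g h} → Short m g → Short n h → Short (m ℕ.+ n) (g ∙ h)
  short-∙ {m} {n} (us , lu , us∈ , g≈) (vs , lv , vs∈ , h≈) =
    us ++ vs ,
    ℕ.≤-trans (ℕ.≤-reflexive (length-++ us)) (ℕ.+-mono-≤ lu lv) ,
    ++⁺ us∈ vs∈ ,
    trans (∙-cong g≈ h≈) (sym (product-++ us vs))

  short-product-⁻¹ : ∀ {n} ws → length ws ℕ.≤ n → All Letter ws → Short n (product G ws ⁻¹)
  short-product-⁻¹ [] _ _ =
    short-resp (solve 0 (𝟏 ⊜ ⊖ 𝟏) refl) short-ε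
  short-product-⁻¹ {suc n} (w ∷ ws) (s≤s len) (l ∷ ls) =
    short-resp (sym (⁻¹-anti-homo-∙ _ _))
      (short-≤ (ℕ.≤-reflexive (ℕ.+-comm n 1))
        (short-∙ (short-product-⁻¹ ws len ls) (short-letter (letter-⁻¹ l))))

  short-⁻¹ : ∀ {n g} → Short n g → Short n (g ⁻¹)
  short-⁻¹ (ws , len , ws∈ , g≈) = short-resp (⁻¹-cong (sym g≈)) (short-product-⁻¹ ws len ws∈)

  -- The common trace of automorphisms of the ball and of the whole graph. The map takes a proof of
  -- shortness because a ball automorphism takes a proof of membership; `ψ-step` at `x = y` makes
  -- the value independent of it.
  record LocallyColoured (ψ : ∀ g → Short 3 g → Carrier) : Set (c ⊔ ℓ) where
    field
      ψ-ε    : ∀ s → ψ ε s ≈ ε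
      ψ-step : ∀ {x y} (sx : Short 3 x) (sy : Short 3 y) → Short 3 (x ⁻¹ ∙ y) →
               ψ y sy ≈ ψ x sx ∙ (x ⁻¹ ∙ y) ⊎ ψ y sy ≈ ψ x sx ∙ (x ⁻¹ ∙ y) ⁻¹

  module Induction (generating : IsGeneratingSet G S) where

    open IsGeneratingSet generating

    word-induction : ∀ {q} (Q : Carrier → Set q) → Q Respects _≈_ → Q ε →
                     (∀ {g h} → Letter g → Q h → Q (g ∙ h)) → ∀ g → Q g
    word-induction Q Q-resp Qε Q∷ g with generates g
    ... | ws , ws∈ , g≈ = Q-resp (sym g≈) (Q-product ws ws∈)
      where
      Q-product : ∀ ws → All Letter ws → Q (product G ws)
      Q-product []       []       = Qε
      Q-product (w ∷ ws) (l ∷ ls) = Q∷ l (Q-product ws ls)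

    letters-commute⇒abelian : (∀ {g h} → Letter g → Letter h → Commutes g h) → IsAbelian G
    letters-commute⇒abelian comm g h =
      word-induction (λ g → Commutes g h) commutes-respˡ (sym commutes-ε)
        (λ l p → commutes-∙ˡ (letter-comm l h) p) g
      where
      letter-comm : ∀ {g} → Letter g → ∀ h → Commutes g h
      letter-comm l = word-induction (Commutes _) commutes-respʳ commutes-ε
        (λ l′ p → commutes-∙ʳ (comm l l′) p)

    -- A criterion for generalized dicyclic groups.

    data Generated {p} (P : Carrier → Set p) : Carrier → Set (c ⊔ ℓ ⊔ p) where
      gen   : ∀ {a} → P a → Generated P a
      unit  : Generated P ε
      mul   : ∀ {a b} → Generated P a → Generated P b → Generated P (a ∙ b)
      inv   : ∀ {a} → Generated P a → Generated P (a ⁻¹)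
      equal : ∀ {a b} → a ≈ b → Generated P a → Generated P b

    -- All conditions are on generators. Commutation and inversion spread from `P` to the subgroup
    -- it generates; as `x` normalises that subgroup and `x²` lies in it, `split` spreads from
    -- letters to a decomposition of `G` into two cosets.
    module DicyclicCriterion
      (P : Carrier → Set (c ⊔ ℓ)) (x : Carrier)
      (nonAbelian : ¬ IsAbelian G)
      (P-commutes : ∀ {a b} → P a → P b → Commutes a b)
      (x-inverts  : ∀ {a} → P a → Inverts x a)
      (P-x²       : P (x ∙ x))
      (x²≉ε       : ¬ (x ∙ x ≈ ε))
      (split      : ∀ {g} → Letter g → P g ⊎ P (g ∙ x))
      where

      private
        A : Carrier → Set (c ⊔ ℓ)
        A = Generated P

        commutes-P : ∀ {a b} → A a → P b → Commutes a b
        commutes-P (gen p)     q = P-commutes p q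
        commutes-P unit        q = sym commutes-ε
        commutes-P (mul a b)   q = commutes-∙ˡ (commutes-P a q) (commutes-P b q)
        commutes-P (inv a)     q = sym (commutes-⁻¹ʳ (sym (commutes-P a q)))
        commutes-P (equal e a) q = commutes-respˡ e (commutes-P a q)

        A-commutes : ∀ {a b} → A a → A b → Commutes a b
        A-commutes a (gen q)     = commutes-P a q
        A-commutes a unit        = commutes-ε
        A-commutes a (mul b b′)  = commutes-∙ʳ (A-commutes a b) (A-commutes a b′)
        A-commutes a (inv b)     = commutes-⁻¹ʳ (A-commutes a b)
        A-commutes a (equal e b) = commutes-respʳ e (A-commutes a b)

        A-inverted : ∀ {a} → A a → Inverts x a
        A-inverted (gen p)     = x-inverts p
        A-inverted unit        = inverts-ε
        A-inverted (mul a b)   = inverts-∙ʳ (A-inverted a) (A-inverted b) (A-commutes a b)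
        A-inverted (inv a)     = inverts-⁻¹ʳ (A-inverted a)
        A-inverted (equal e a) = inverts-respʳ e (A-inverted a)

        inverts⇒conjugate : ∀ {a} → Inverts x a → x ∙ a ∙ x ⁻¹ ≈ a ⁻¹
        inverts⇒conjugate {a} p = trans (∙-congʳ p)
          (solve 2 (λ x a → ⊖ a ⊕ x ⊕ ⊖ x ⊜ ⊖ a) refl x a)

        conjugate⁻¹ : ∀ {a} → A a → A (x ⁻¹ ∙ a ∙ x)
        conjugate⁻¹ {a} p = equal (begin
          a ⁻¹                ≈⟨ solve 2 (λ x a → ⊖ a ⊜ ⊖ x ⊕ (x ⊕ ⊖ a)) refl x a ⟩
          x ⁻¹ ∙ (x ∙ a ⁻¹)   ≈⟨ ∙-congˡ (inverts-flip (A-inverted p)) ⟩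
          x ⁻¹ ∙ (a ∙ x)      ≈⟨ assoc _ _ _ ⟨
          x ⁻¹ ∙ a ∙ x        ∎) (inv p)

        x²∈A : A (x ∙ x)
        x²∈A = gen P-x²

        cosets : ∀ g → A g ⊎ A (g ∙ x)
        cosets = word-induction (λ g → A g ⊎ A (g ∙ x))
          (λ { e (inj₁ a) → inj₁ (equal e a) ; e (inj₂ a) → inj₂ (equal (∙-congʳ e) a) })
          (inj₁ unit)
          λ {g} {h} l → λ
            { (inj₁ b) → [ (λ p → inj₁ (mul (gen p) b))
                         , (λ p → inj₂ (equal
                             (solve 3 (λ g h x → g ⊕ x ⊕ (⊖ x ⊕ h ⊕ x) ⊜ g ⊕ h ⊕ x) refl g h x)
                             (mul (gen p) (conjugate⁻¹ b))))
                         ]′ (split l)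
            ; (inj₂ b) → [ (λ p → inj₂ (equal (sym (assoc _ _ _)) (mul (gen p) b)))
                         -- Moving `x` past `h ∙ x` leaves a surplus factor `x²`, which is removed
                         -- inside `A`.
                         , (λ p → inj₁ (equal
                             (solve 3 (λ g h x → g ⊕ x ⊕ (⊖ x ⊕ (h ⊕ x) ⊕ x) ⊕ ⊖ (x ⊕ x) ⊜ g ⊕ h)
                               refl g h x)
                             (mul (mul (gen p) (conjugate⁻¹ b)) (inv x²∈A))))
                         ]′ (split l)
            }

        x∉A : ¬ A x
        x∉A a = x²≉ε (commutes∧inverts⇒involution commutes-refl (A-inverted a))

        -- `HasIndex` tests `r ⁻¹ ∙ g`, whereas `cosets` yields `g ∙ x`.
        left-coset : ∀ {g} → A (g ∙ x) → A (x ⁻¹ ∙ g)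
        left-coset {g} a = equal
          (solve 2 (λ x g → ⊖ x ⊕ (g ⊕ x) ⊕ x ⊕ ⊖ (x ⊕ x) ⊜ ⊖ x ⊕ g) refl x g)
          (mul (conjugate⁻¹ a) (inv x²∈A))

        conjugate-any : ∀ g {a} → A a → A (g ∙ a ∙ g ⁻¹)
        conjugate-any g {a} p with cosets g
        ... | inj₁ q = mul (mul q p) (inv q)
        ... | inj₂ q = equal
          (solve 3 (λ g a x → g ⊕ x ⊕ (⊖ x ⊕ a ⊕ x) ⊕ ⊖ (g ⊕ x) ⊜ g ⊕ a ⊕ ⊖ g) refl g a x)
          (mul (mul q (conjugate⁻¹ p)) (inv q))

        representative : Fin 2 → Carrier
        representative Fin.zero    = ε
        representative (Fin.suc _) = x

        ε⁻¹∙ : ∀ g → ε ⁻¹ ∙ g ≈ g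
        ε⁻¹∙ g = solve 1 (λ g → ⊖ 𝟏 ⊕ g ⊜ g) refl g

        not-both : ∀ {g} → A g → ¬ A (x ⁻¹ ∙ g)
        not-both {g} a b = x∉A (equal
          (solve 2 (λ x g → g ⊕ ⊖ (⊖ x ⊕ g) ⊜ x) refl x g) (mul a (inv b)))

        x⁴≈ε : (x ∙ x) ∙ (x ∙ x) ≈ ε
        x⁴≈ε = commutes∧inverts⇒involution (commutes-∙ʳ commutes-refl commutes-refl) (x-inverts P-x²)

      generalizedDicyclic : IsGeneralizedDicyclic G
      generalizedDicyclic = record
        { nonAbelian = nonAbelian
        ; A          = record { Member = A ; resp = equal }
        ; A-normal   = record
          { isSubgroup = record { ε-closed = unit ; ∙-closed = mul ; ⁻¹-closed = inv }
          ; normal     = conjugate-any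
          }
        ; A-abelian  = A-commutes
        ; A-index    = representative , index
        ; x          = x
        ; x∉A        = x∉A
        ; x-order    = s≤s z≤n
                     , trans (solve 1 (λ x → x ⊕ (x ⊕ (x ⊕ (x ⊕ 𝟏))) ⊜ x ⊕ x ⊕ (x ⊕ x)) refl x) x⁴≈ε
                     , order-4
        ; inverts    = λ a → inverts⇒conjugate (A-inverted a)
        }
        where
        index : ∀ g → _
        index g with cosets g
        ... | inj₁ a = Fin.zero , equal (sym (ε⁻¹∙ g)) a , λ
          { {Fin.zero} _         → ≡.refl
          ; {Fin.suc Fin.zero} b → contradiction b (not-both a) }
        ... | inj₂ a = Fin.suc Fin.zero , left-coset a , λ
          { {Fin.zero} b         → contradiction (left-coset a) (not-both (equal (ε⁻¹∙ g) b))
          ; {Fin.suc Fin.zero} _ → ≡.refl }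

        order-4 : ∀ m → 0 ℕ.< m → m ℕ.< 4 → _
        order-4 1 _ _ e = x²≉ε (trans (∙-cong x≈ε x≈ε) (identityˡ ε))
          where x≈ε = trans (sym (identityʳ x)) e
        order-4 2 _ _ e = x²≉ε (trans (∙-congˡ (sym (identityʳ x))) e)
        -- If `x³` is trivial, then `x⁴ ∙ x` is `x²`; it is also `x`, so `x` would lie in `A`.
        order-4 3 _ _ e = x∉A (equal
          (between (x ∙ x) ε
            (solve 1 (λ x → x ⊕ x ⊜ x ⊕ x ⊕ (𝟏 ⊕ 𝟏)) refl x)
            (trans (solve 1 (λ x → x ⊕ x ⊕ (x ⊕ (x ⊕ (x ⊕ 𝟏)) ⊕ 𝟏) ⊜ (x ⊕ x) ⊕ (x ⊕ x) ⊕ x) refl x)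
                   (trans (∙-congʳ x⁴≈ε) (identityˡ x))) (sym e)) x²∈A)
        order-4 (suc (suc (suc (suc _)))) _ (s≤s (s≤s (s≤s (s≤s ()))))

-- Fixed and moved elements of a local map.

module LocalAutomorphism
  (em : ∀ {a} → ExcludedMiddle a)
  {c ℓ : Level} (G : Group c ℓ) (S : Subset G (c ⊔ ℓ)) (generating : IsGeneratingSet G S)
  (ψ : ∀ g → Words.Short G S 3 g → Group.Carrier G) (ψ-coloured : Words.LocallyColoured G S ψ)
  where

  open Group G
  open GroupSolver G using (solve; _⊜_; _⊕_; ⊖_; 𝟏)
  open CommutesInverts G
  open Words G S
  open Induction generating
  open LocallyColoured ψ-coloured
  open Algebra.Properties.Group G using (∙-cancelʳ)
  open Relation.Binary.Reasoning.Setoid setoid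

  Moved : Carrier → Set (c ⊔ ℓ)
  Moved g = ∃[ s ] ¬ (ψ g s ≈ g)

  Fixed : Carrier → Set (c ⊔ ℓ)
  Fixed g = ∃[ s ] ψ g s ≈ g

  status : ∀ {g} → Short 3 g → Moved g ⊎ Fixed g
  status {g} s with em {P = ψ g s ≈ g}
  ... | yes p = inj₂ (s , p)
  ... | no ¬p = inj₁ (s , ¬p)

  moved⇒⁻¹ : ∀ {g} ((s , _) : Moved g) → ψ g s ≈ g ⁻¹
  moved⇒⁻¹ {g} (s , ψg≉g)
    with ψ-step short-ε s (short-resp (solve 1 (λ g → g ⊜ ⊖ 𝟏 ⊕ g) refl g) s)
  ... | inj₁ e = contradiction
    (trans e (trans (∙-congʳ (ψ-ε _)) (solve 1 (λ g → 𝟏 ⊕ (⊖ 𝟏 ⊕ g) ⊜ g) refl g))) ψg≉g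
  ... | inj₂ e = trans e (trans (∙-congʳ (ψ-ε _)) (solve 1 (λ g → 𝟏 ⊕ ⊖ (⊖ 𝟏 ⊕ g) ⊜ ⊖ g) refl g))

  moved⇒not-involution : ∀ {g} → Moved g → ¬ (g ∙ g ≈ ε)
  moved⇒not-involution m@(_ , ψg≉g) e = ψg≉g (trans (moved⇒⁻¹ m) (sym (involution⇒⁻¹≈ e)))

  -- One sign along the edge gives `y ≈ x⁻² ∙ y`, impossible because a moved `x` is no involution;
  -- the other sign is the claim.
  moved-inverts-fixed : ∀ {x y} → Short 3 (x ⁻¹ ∙ y) → Moved x → Fixed y → Inverts x y
  moved-inverts-fixed {x} {y} d mx (sy , ψy≈y) with ψ-step (proj₁ mx) sy d
  ... | inj₁ e = contradiction
    (between (x ∙ x) (y ⁻¹)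
      (solve 2 (λ x y → x ⊕ x ⊜ x ⊕ x ⊕ (y ⊕ ⊖ y)) refl x y)
      (solve 2 (λ x y → x ⊕ x ⊕ (⊖ x ⊕ (⊖ x ⊕ y) ⊕ ⊖ y) ⊜ 𝟏) refl x y)
      (trans (sym ψy≈y) (trans e (∙-congʳ (moved⇒⁻¹ mx)))))
    (moved⇒not-involution mx)
  ... | inj₂ e = between x ε
      (solve 2 (λ x y → x ⊕ y ⊜ x ⊕ (y ⊕ 𝟏)) refl x y)
      (solve 2 (λ x y → x ⊕ (⊖ x ⊕ ⊖ (⊖ x ⊕ y) ⊕ 𝟏) ⊜ ⊖ y ⊕ x) refl x y)
      (trans (sym ψy≈y) (trans e (∙-congʳ (moved⇒⁻¹ mx))))

  moved-pair : ∀ {x y} → Short 3 (x ⁻¹ ∙ y) → Moved x → Moved y →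
               Commutes x y ⊎ x ∙ x ≈ y ∙ y
  moved-pair {x} {y} d mx my with ψ-step (proj₁ mx) (proj₁ my) d
  ... | inj₁ e = inj₂ (between (x ∙ x) y
      (solve 2 (λ x y → x ⊕ x ⊜ x ⊕ x ⊕ (⊖ y ⊕ y)) refl x y)
      (solve 2 (λ x y → x ⊕ x ⊕ (⊖ x ⊕ (⊖ x ⊕ y) ⊕ y) ⊜ y ⊕ y) refl x y)
      (trans (sym (moved⇒⁻¹ my)) (trans e (∙-congʳ (moved⇒⁻¹ mx)))))
  ... | inj₂ e = inj₁ (sym (between (y ∙ x) y
      (solve 2 (λ x y → y ⊕ x ⊜ y ⊕ x ⊕ (⊖ y ⊕ y)) refl x y)
      (solve 2 (λ x y → y ⊕ x ⊕ (⊖ x ⊕ ⊖ (⊖ x ⊕ y) ⊕ y) ⊜ x ⊕ y) refl x y)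
      (trans (sym (moved⇒⁻¹ my)) (trans e (∙-congʳ (moved⇒⁻¹ mx))))))

  -- The length budget of a comparison along the path through `ε`; for numerals the bound is settled
  -- by computation.
  near : ∀ {m n x y} {_ : True (m ℕ.+ n ℕ.≤? 3)} → Short m x → Short n y → Short 3 (x ⁻¹ ∙ y)
  near {_} {_} {_} {_} {m+n≤3} sx sy = short-≤ (toWitness m+n≤3) (short-∙ (short-⁻¹ sx) sy)

  MovedLetter : Carrier → Set (c ⊔ ℓ)
  MovedLetter g = Letter g × Moved g

  FixedLetter : Carrier → Set (c ⊔ ℓ)
  FixedLetter g = Letter g × Fixed g

  short₁ : ∀ {g} → Letter g → Short 1 g
  short₁ = short-letter

  short₂ : ∀ {g h} → Letter g → Letter h → Short 2 (g ∙ h)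
  short₂ g h = short-∙ (short₁ g) (short₁ h)

  letter-status : ∀ {g} → Letter g → MovedLetter g ⊎ FixedLetter g
  letter-status l with status (short-≤ (s≤s z≤n) (short₁ l))
  ... | inj₁ m = inj₁ (l , m)
  ... | inj₂ f = inj₂ (l , f)

  product-status : ∀ {g h} → Letter g → Letter h → Moved (g ∙ h) ⊎ Fixed (g ∙ h)
  product-status g h = status (short-≤ (s≤s (s≤s z≤n)) (short₂ g h))

  letter-inverts-letter : ∀ {g h} → MovedLetter g → FixedLetter h → Inverts g h
  letter-inverts-letter (lg , mg) (lh , fh) = moved-inverts-fixed (near (short₁ lg) (short₁ lh)) mg fh

  letter-inverts-product : ∀ {g a b} → MovedLetter g → Letter a → Letter b → Fixed (a ∙ b) →
                           Inverts g (a ∙ b)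
  letter-inverts-product (lg , mg) la lb = moved-inverts-fixed (near (short₁ lg) (short₂ la lb)) mg

  product-inverts-letter : ∀ {a b g} → Letter a → Letter b → Moved (a ∙ b) → FixedLetter g →
                           Inverts (a ∙ b) g
  product-inverts-letter la lb m (lg , fg) = moved-inverts-fixed (near (short₂ la lb) (short₁ lg)) m fg

  -- A fixed `g ⁻¹` would be inverted by the moved `g`, with which it commutes, and `g` would be an
  -- involution.
  moved-⁻¹ : ∀ {g} → MovedLetter g → MovedLetter (g ⁻¹)
  moved-⁻¹ {g} m@(l , mg) with letter-status (letter-⁻¹ l)
  ... | inj₁ m′ = m′
  ... | inj₂ f  = contradiction
    (trans (solve 1 (λ g → g ⊕ g ⊜ ⊖ (⊖ g ⊕ ⊖ g)) refl g)
      (trans (⁻¹-cong (commutes∧inverts⇒involution (commutes-⁻¹ʳ commutes-refl)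
                        (letter-inverts-letter m f)))
             (solve 0 (⊖ 𝟏 ⊜ 𝟏) refl)))
    (moved⇒not-involution mg)

  -- Nonabelian groups with a moved generator: the squares.

  module NonAbelian {s₀ : Carrier} (m₀ : MovedLetter s₀) (nonAbelian : ¬ IsAbelian G) where

    -- If `g ∙ h` is fixed, then `s₀` inverts `g`, `h` and their product. If it is moved, it inverts
    -- both of its factors, and one factor cancels in each relation.
    fixed-pair : ∀ {g h} → FixedLetter g → FixedLetter h →
                 Commutes g h ⊎ Moved (g ∙ h) × Inverts g h × Inverts h g
    fixed-pair {g} {h} fg fh with product-status (proj₁ fg) (proj₁ fh)
    ... | inj₂ f = inj₁ (inverts-product⇒commutes
      (letter-inverts-letter m₀ fg) (letter-inverts-letter m₀ fh)
      (letter-inverts-product m₀ (proj₁ fg) (proj₁ fh) f))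
    ... | inj₁ m = inj₂ (m
      , product-inverts-right (product-inverts-letter (proj₁ fg) (proj₁ fh) m fh)
      , product-inverts-left (product-inverts-letter (proj₁ fg) (proj₁ fh) m fg))

    -- The case `s = u` gives trivial fourth powers, so this one formula says that the squares of
    -- moved letters coincide and, being non-trivial, have order 2.
    Squares : Set (c ⊔ ℓ)
    Squares = ∀ {s u} → MovedLetter s → MovedLetter u → (s ∙ s) ∙ (u ∙ u) ≈ ε

    -- A moved `s ∙ u` would invert `t`, yet commute with it because both factors invert `t`. So
    -- `s ∙ u` is fixed, and `s` inverts it.
    non-involution⇒squares : ∀ {t} → FixedLetter t → ¬ (t ∙ t ≈ ε) → Squares
    non-involution⇒squares ft t²≉ε {s} {u} ms@(ls , _) mu@(lu , _) with product-status ls lu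
    ... | inj₂ f = inverts-own-product⇒squares (letter-inverts-product ms ls lu f)
    ... | inj₁ m = contradiction
      (commutes∧inverts⇒involution
        (inverts-∙ˡ (letter-inverts-letter ms ft) (letter-inverts-letter mu ft))
        (product-inverts-letter ls lu m ft))
      t²≉ε

    -- Both `u` and `u ⁻¹` are moved and do not commute with `s`, so `s²` equals `u²` and `u⁻²`.
    -- Every other moved letter is then compared with `s²`.
    noncommuting⇒squares : ∀ {s u} → MovedLetter s → MovedLetter u → ¬ Commutes s u → Squares
    noncommuting⇒squares {s} {u} ms@(ls , s-moved) mu@(lu , u-moved) s∦u mv mw =
      squares-trans (to-s² mv) s⁴≈ε (squares-swap (to-s² mw))
      where
      letter-pair : ∀ {a b} → MovedLetter a → MovedLetter b → ¬ Commutes a b → a ∙ a ≈ b ∙ b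
      letter-pair (la , ma) (lb , mb) ¬comm with moved-pair (near (short₁ la) (short₁ lb)) ma mb
      ... | inj₁ comm = contradiction comm ¬comm
      ... | inj₂ e    = e

      s²≈u² : s ∙ s ≈ u ∙ u
      s²≈u² = letter-pair ms mu s∦u

      s²≈u⁻² : s ∙ s ≈ u ⁻¹ ∙ u ⁻¹
      s²≈u⁻² = letter-pair ms (moved-⁻¹ mu) λ comm →
        s∦u (commutes-respʳ (solve 1 (λ u → ⊖ ⊖ u ⊜ u) refl u) (commutes-⁻¹ʳ comm))

      s⁴≈ε : (s ∙ s) ∙ (s ∙ s) ≈ ε
      s⁴≈ε = trans (∙-cong s²≈u⁻² s²≈u²)
        (solve 1 (λ u → ⊖ u ⊕ ⊖ u ⊕ (u ⊕ u) ⊜ 𝟏) refl u)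

      to-s² : ∀ {v} → MovedLetter v → (v ∙ v) ∙ (s ∙ s) ≈ ε
      to-s² {v} mv@(lv , v-moved) with em {P = Commutes v s} | em {P = Commutes v u}
      ... | no ¬comm | _        = trans (∙-congʳ (letter-pair mv ms ¬comm)) s⁴≈ε
      ... | yes _    | no ¬comm = trans (∙-congʳ (trans (letter-pair mv mu ¬comm) (sym s²≈u²))) s⁴≈ε
      ... | yes vs   | yes vu with product-status lv ls
      ...   | inj₂ f = inverts-own-product⇒squares (letter-inverts-product mv lv ls f)
      -- Here `v` commutes with `s` and `u`. A moved `v ∙ s` cannot commute with `u`, so its square
      -- `v² ∙ s²` would be `u²`, that is `s²`, and `v` an involution.
      ...   | inj₁ m with moved-pair (near (short₂ lv ls) (short₁ lu)) m u-moved
      ...     | inj₁ comm = contradiction (commutes-cancelˡ comm vu) s∦u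
      ...     | inj₂ e    = contradiction
        (begin
          v ∙ v                          ≈⟨ solve 2 (λ v s → v ⊕ v ⊜ v ⊕ (v ⊕ s ⊕ s) ⊕ ⊖ (s ⊕ s)) refl v s ⟩
          v ∙ (v ∙ s ∙ s) ∙ (s ∙ s) ⁻¹   ≈⟨ ∙-congʳ (∙-congˡ (∙-congʳ vs)) ⟩
          v ∙ (s ∙ v ∙ s) ∙ (s ∙ s) ⁻¹   ≈⟨ ∙-congʳ (solve 2 (λ v s → v ⊕ (s ⊕ v ⊕ s) ⊜ v ⊕ s ⊕ (v ⊕ s)) refl v s) ⟩
          v ∙ s ∙ (v ∙ s) ∙ (s ∙ s) ⁻¹   ≈⟨ ∙-congʳ (trans e (sym s²≈u²)) ⟩
          s ∙ s ∙ (s ∙ s) ⁻¹             ≈⟨ inverseʳ _ ⟩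
          ε                              ∎)
        (moved⇒not-involution v-moved)

    module _ (fixed-involutions : ∀ {t} → FixedLetter t → t ∙ t ≈ ε) where

      moved-commutes-fixed : ∀ {s t} → MovedLetter s → FixedLetter t → Commutes s t
      moved-commutes-fixed ms ft =
        inverts∧involution⇒commutes (letter-inverts-letter ms ft) (fixed-involutions ft)

      fixed-letters-commute : ∀ {t u} → FixedLetter t → FixedLetter u → Commutes t u
      fixed-letters-commute ft fu with fixed-pair ft fu
      ... | inj₁ comm            = comm
      ... | inj₂ (_ , t-inv , _) = inverts∧involution⇒commutes t-inv (fixed-involutions fu)

      moved-commute⇒abelian : (∀ {s u} → MovedLetter s → MovedLetter u → Commutes s u) → IsAbelian G
      moved-commute⇒abelian comm = letters-commute⇒abelian λ lg lh →
        commute (letter-status lg) (letter-status lh)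
        where
        commute : ∀ {g h} → MovedLetter g ⊎ FixedLetter g → MovedLetter h ⊎ FixedLetter h → Commutes g h
        commute (inj₁ mg) (inj₁ mh) = comm mg mh
        commute (inj₁ mg) (inj₂ fh) = moved-commutes-fixed mg fh
        commute (inj₂ fg) (inj₁ mh) = sym (moved-commutes-fixed mh fg)
        commute (inj₂ fg) (inj₂ fh) = fixed-letters-commute fg fh

    -- If neither previous lemma applies, fixed letters are involutions, so inverting them means
    -- commuting with them, and all letters commute.
    squares : Squares
    squares with em {P = ∃[ t ] FixedLetter t × ¬ (t ∙ t ≈ ε)}
    ... | yes (t , ft , t²≉ε) = non-involution⇒squares ft t²≉ε
    ... | no all-involutions with em {P = ∃[ s ] ∃[ u ] MovedLetter s × MovedLetter u × ¬ Commutes s u}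
    ...   | yes (s , u , ms , mu , s∦u) = noncommuting⇒squares ms mu s∦u
    ...   | no all-commute = contradiction
      (moved-commute⇒abelian
        (λ {t} ft → decidable-stable em (λ ¬p → all-involutions (t , ft , ¬p)))
        (λ {s} {u} ms mu → decidable-stable em (λ ¬p → all-commute (s , u , ms , mu , ¬p))))
      nonAbelian

    -- A is generated by the letters commuting with i and the products g j with g inverting i.
    module QuaternionicPair
      {i j : Carrier} (lj : Letter j) (j-inverts-i : Inverts j i) (j²≉ε : ¬ (j ∙ j ≈ ε))
      (split-i : ∀ {g} → Letter g → Commutes g i ⊎ Inverts g i)
      (squares-j : ∀ {g} → Letter g → Inverts g i → (g ∙ g) ∙ (j ∙ j) ≈ ε)
      (commuting : ∀ {g h} → Letter g → Letter h → Commutes g i → Commutes h i → Commutes g h)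
      (mixed : ∀ {g h} → Letter g → Letter h → Commutes g i → Inverts h i → Inverts h g)
      (swap : ∀ {g h} → Letter g → Letter h → Inverts g i → Inverts h i → g ∙ j ∙ h ≈ h ∙ j ∙ g)
      where

      P : Carrier → Set (c ⊔ ℓ)
      P a = (∃[ g ] Letter g × Commutes g i × g ≈ a) ⊎ (∃[ g ] Letter g × Inverts g i × g ∙ j ≈ a)

      -- For a letter against a product, both `h` and `j` invert `g`, so `h ∙ j` commutes with it.
      P-commutes : ∀ {a b} → P a → P b → Commutes a b
      P-commutes (inj₁ (g , lg , p , ea)) (inj₁ (h , lh , q , eb)) =
        commutes-respˡ ea (commutes-respʳ eb (commuting lg lh p q))
      P-commutes (inj₁ (g , lg , p , ea)) (inj₂ (h , lh , q , eb)) =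
        commutes-respˡ ea (commutes-respʳ eb
          (sym (inverts-∙ˡ (mixed lg lh p q) (mixed lg lj p j-inverts-i))))
      P-commutes a@(inj₂ _) b@(inj₁ _) = sym (P-commutes b a)
      P-commutes (inj₂ (g , lg , p , ea)) (inj₂ (h , lh , q , eb)) =
        commutes-respˡ ea (commutes-respʳ eb (swap⇒commutes (swap lg lh p q)))

      j-inverts : ∀ {a} → P a → Inverts j a
      j-inverts (inj₁ (g , lg , p , ea)) = inverts-respʳ ea (mixed lg lj p j-inverts-i)
      -- The relation amounts to `j ∙ g ≈ j ⁻¹ ∙ g ⁻¹`, which is what `squares-j` provides.
      j-inverts (inj₂ (g , lg , p , ea)) = inverts-respʳ ea (begin
        j ∙ (g ∙ j)       ≈⟨ assoc _ _ _ ⟨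
        j ∙ g ∙ j         ≈⟨ ∙-congʳ (squares⇒⁻¹⁻¹ (squares-swap (squares-j lg p))) ⟨
        j ⁻¹ ∙ g ⁻¹ ∙ j   ≈⟨ ∙-congʳ (solve 2 (λ g j → ⊖ j ⊕ ⊖ g ⊜ ⊖ (g ⊕ j)) refl g j) ⟩
        (g ∙ j) ⁻¹ ∙ j    ∎)

      P-split : ∀ {g} → Letter g → P g ⊎ P (g ∙ j)
      P-split lg with split-i lg
      ... | inj₁ p = inj₁ (inj₁ (_ , lg , p , refl))
      ... | inj₂ p = inj₂ (inj₂ (_ , lg , p , refl))

      open DicyclicCriterion P j nonAbelian P-commutes j-inverts
        (inj₂ (j , lj , j-inverts-i , refl)) j²≉ε P-split
        public using (generalizedDicyclic)

    -- Two fixed generators with a moved product.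

    module FixedPair {i j : Carrier} (fi : FixedLetter i) (fj : FixedLetter j)
                     (k-moved : Moved (i ∙ j)) where

      private
        li = proj₁ fi
        lj = proj₁ fj

      k-inverts : ∀ {g} → FixedLetter g → Inverts (i ∙ j) g
      k-inverts = product-inverts-letter li lj k-moved

      i-inverts-j : Inverts i j
      i-inverts-j = product-inverts-right (k-inverts fj)

      j-inverts-i : Inverts j i
      j-inverts-i = product-inverts-left (k-inverts fi)

      k²≈j² : (i ∙ j) ∙ (i ∙ j) ≈ j ∙ j
      k²≈j² = inverts⇒product-square j-inverts-i

      j²≉ε : ¬ (j ∙ j ≈ ε)
      j²≉ε e = moved⇒not-involution k-moved (trans k²≈j² e)

      i²j²≈ε : (i ∙ i) ∙ (j ∙ j) ≈ ε
      i²j²≈ε = mutually-inverting⇒squares i-inverts-j j-inverts-i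

      i²≉ε : ¬ (i ∙ i ≈ ε)
      i²≉ε e = j²≉ε (trans (sym (identityˡ _)) (trans (∙-congʳ (sym e)) i²j²≈ε))

      -- Together with the relations above it, this makes the subgroup generated by `i` and `j` a
      -- quaternion group of order 8.
      i⁴≈ε : (i ∙ i) ∙ (i ∙ i) ≈ ε
      i⁴≈ε = mutually-inverting⇒fourth-power j-inverts-i i-inverts-j

      inverts⇒∦ : ∀ {g} → Inverts g i → ¬ Commutes g i
      inverts⇒∦ p q = i²≉ε (commutes∧inverts⇒involution q p)

      split-i : ∀ {g} → Letter g → Commutes g i ⊎ Inverts g i
      split-i lg with letter-status lg
      ... | inj₁ mg = inj₂ (letter-inverts-letter mg fi)
      ... | inj₂ fg with fixed-pair fg fi
      ...   | inj₁ p           = inj₁ p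
      ...   | inj₂ (_ , p , _) = inj₂ p

      commuting⇒fixed : ∀ {g} → Letter g → Commutes g i → FixedLetter g
      commuting⇒fixed lg p with letter-status lg
      ... | inj₁ mg = contradiction p (inverts⇒∦ (letter-inverts-letter mg fi))
      ... | inj₂ fg = fg

      fixed-inverting : ∀ {h} → FixedLetter h → Inverts h i → Moved (i ∙ h) × Inverts i h
      fixed-inverting fh q with fixed-pair fi fh
      ... | inj₁ comm        = contradiction (sym comm) (inverts⇒∦ q)
      ... | inj₂ (m , p , _) = m , p

      -- Both letters are fixed; a moved `g ∙ h` would invert `i` while commuting with it.
      commuting : ∀ {g h} → Letter g → Letter h → Commutes g i → Commutes h i → Commutes g h
      commuting lg lh p q with fixed-pair (commuting⇒fixed lg p) (commuting⇒fixed lh q)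
      ... | inj₁ comm     = comm
      ... | inj₂ (m , _)  = contradiction (commutes-∙ˡ p q)
        (inverts⇒∦ (product-inverts-letter lg lh m fi))

      -- The delicate case has `h` fixed and commuting with `g`. Then the moved `i ∙ h` both
      -- commutes with `g` and inverts it, so `g` is an involution and commuting amounts to
      -- inverting.
      mixed : ∀ {g h} → Letter g → Letter h → Commutes g i → Inverts h i → Inverts h g
      mixed {g} {h} lg lh p q with letter-status lh | commuting⇒fixed lg p
      ... | inj₁ mh | fg = letter-inverts-letter mh fg
      ... | inj₂ fh | fg with fixed-pair fh fg
      ...   | inj₂ (_ , r , _) = r
      ...   | inj₁ r           = commutes∧involution⇒inverts r
        (commutes∧inverts⇒involution (commutes-∙ˡ (sym p) r)
          (product-inverts-letter li lh (proj₁ (fixed-inverting fh q)) fg))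

      squares-j : ∀ {g} → Letter g → Inverts g i → (g ∙ g) ∙ (j ∙ j) ≈ ε
      squares-j {g} lg p with letter-status lg
      ... | inj₂ fg = squares-trans
        (mutually-inverting⇒squares p (proj₂ (fixed-inverting fg p))) i⁴≈ε i²j²≈ε
      -- The word `i ∙ (j ∙ g)` has the full length 3. If moved, it would invert `i`, although it
      -- commutes with `i` because `j` and `g` invert `i`. If fixed, it is inverted by its prefix
      -- `i ∙ j`, whose square is `j²`.
      ... | inj₁ mg with status (short-∙ (short₁ li) (short₂ lj lg))
      ...   | inj₁ m = contradiction
        (commutes-∙ˡ commutes-refl (inverts-∙ˡ j-inverts-i p))
        (inverts⇒∦ (moved-inverts-fixed
          (short-resp (solve 3 (λ i j g → ⊖ (j ⊕ g) ⊜ ⊖ (i ⊕ (j ⊕ g)) ⊕ i) refl i j g)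
            (short-≤ (s≤s (s≤s z≤n)) (short-⁻¹ (short₂ lj lg)))) m (proj₂ fi)))
      ...   | inj₂ f = trans (∙-congˡ (sym k²≈j²)) (squares-swap (inverts-own-product⇒squares
        (inverts-respʳ (sym (assoc _ _ _)) (moved-inverts-fixed
          (short-resp (solve 3 (λ i j g → g ⊜ ⊖ (i ⊕ j) ⊕ (i ⊕ (j ⊕ g))) refl i j g)
            (short-≤ (s≤s z≤n) (short₁ lg))) k-moved f))))

      -- A moved `i ∙ g` would invert `j` and commute with it, so `i ∙ g` is fixed and `h` inverts
      -- it as well as `i`. Conjugation by `h` then sends `g`, written as `i ⁻¹ ∙ (i ∙ g)`, to
      -- `i ∙ (i ∙ g) ⁻¹`, which is `i² ∙ g ⁻¹`, and this is `g` because `i²` equals `g²`.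
      moved-commute : ∀ {g h} → MovedLetter g → MovedLetter h → Commutes g h
      moved-commute {g} {h} mg@(lg , _) mh with product-status li lg
      ... | inj₁ m = contradiction
        (commutes∧inverts⇒involution (inverts-∙ˡ i-inverts-j (letter-inverts-letter mg fj))
          (product-inverts-letter li lg m fj))
        j²≉ε
      ... | inj₂ f = sym (begin
        h ∙ g                        ≈⟨ solve 3 (λ g h i → h ⊕ g ⊜ i ⊕ (⊖ i ⊕ h) ⊕ g) refl g h i ⟩
        i ∙ (i ⁻¹ ∙ h) ∙ g           ≈⟨ ∙-congʳ (∙-congˡ (letter-inverts-letter mh fi)) ⟨
        i ∙ (h ∙ i) ∙ g              ≈⟨ solve 3 (λ g h i → i ⊕ (h ⊕ i) ⊕ g ⊜ i ⊕ (h ⊕ (i ⊕ g))) refl g h i ⟩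
        i ∙ (h ∙ (i ∙ g))            ≈⟨ ∙-congˡ (letter-inverts-product mh li lg f) ⟩
        i ∙ ((i ∙ g) ⁻¹ ∙ h)         ≈⟨ ∙-congˡ (∙-congʳ (⁻¹-cong (inverts-flip g-inverts-i))) ⟨
        i ∙ ((g ∙ i ⁻¹) ⁻¹ ∙ h)      ≈⟨ solve 3 (λ g h i → i ⊕ (⊖ (g ⊕ ⊖ i) ⊕ h) ⊜ i ⊕ i ⊕ (⊖ g ⊕ h)) refl g h i ⟩
        i ∙ i ∙ (g ⁻¹ ∙ h)           ≈⟨ ∙-congʳ i²≈g² ⟩
        g ∙ g ∙ (g ⁻¹ ∙ h)           ≈⟨ solve 2 (λ g h → g ⊕ g ⊕ (⊖ g ⊕ h) ⊜ g ⊕ h) refl g h ⟩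
        g ∙ h                        ∎)
        where
        g-inverts-i = letter-inverts-letter mg fi
        i²≈g² : i ∙ i ≈ g ∙ g
        i²≈g² = ∙-cancelʳ _ _ _ (trans i²j²≈ε (sym (squares-j lg g-inverts-i)))

      -- Otherwise `i` and `j` both invert `h`, so the moved `i ∙ j` commutes with `h` and inverts
      -- it. Then `h` is an involution, and `i` commutes with it.
      fixed-commutes-j : ∀ {h} → FixedLetter h → Inverts h i → Commutes h j
      fixed-commutes-j {h} fh q with fixed-pair fh fj
      ... | inj₁ comm                = comm
      ... | inj₂ (_ , _ , j-inverts-h) = contradiction
        (sym (inverts∧involution⇒commutes i-inverts-h
          (commutes∧inverts⇒involution (inverts-∙ˡ i-inverts-h j-inverts-h) (k-inverts fh))))
        (inverts⇒∦ q)
        where i-inverts-h = proj₂ (fixed-inverting fh q)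

      -- Among letters that invert `i`, the moved ones invert `j` and the fixed ones commute with
      -- it.
      swap : ∀ {g h} → Letter g → Letter h → Inverts g i → Inverts h i → g ∙ j ∙ h ≈ h ∙ j ∙ g
      swap lg lh p q with letter-status lg | letter-status lh
      ... | inj₁ mg | inj₁ mh =
        swap-inverting (letter-inverts-letter mg fj) (letter-inverts-letter mh fj) (moved-commute mg mh)
      ... | inj₁ mg | inj₂ fh =
        swap-mixed (letter-inverts-letter mg fj) (fixed-commutes-j fh q)
          (letter-inverts-letter mg fh) (squares-j lh q)
      ... | inj₂ fg | inj₁ mh = sym
        (swap-mixed (letter-inverts-letter mh fj) (fixed-commutes-j fg p)
          (letter-inverts-letter mh fg) (squares-j lg p))
      ... | inj₂ fg | inj₂ fh =
        swap-commuting gj hj (commute (fixed-pair fg fh))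
        where
        gj = fixed-commutes-j fg p
        hj = fixed-commutes-j fh q
        commute : _ → _
        commute (inj₁ comm)    = comm
        commute (inj₂ (m , _)) = contradiction
          (commutes∧inverts⇒involution (commutes-∙ˡ gj hj) (product-inverts-letter lg lh m fj))
          j²≉ε

      open QuaternionicPair lj j-inverts-i j²≉ε split-i squares-j commuting mixed swap
        public using (generalizedDicyclic)

    -- Two moved generators with a moved product.

    inverting-moved-pair : ∀ {g h} → MovedLetter g → MovedLetter h → Moved (g ∙ h) →
                           Inverts g h × Inverts h g
    inverting-moved-pair {g} {h} mg@(lg , g-moved) mh@(lh , _) gh-moved = p , squares-inverse⇒inverts (squares mg mh) p
      where
      p : Inverts g h
      p with moved-pair
        (short-resp (solve 2 (λ g h → h ⊜ ⊖ g ⊕ (g ⊕ h)) refl g h) (short-≤ (s≤s z≤n) (short₁ lh)))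
        g-moved gh-moved
      -- If `g` commuted with `g ∙ h`, then `squares` would make `g ∙ h` an involution. In the other
      -- case, the equality of their squares cancels to `g ≈ h ∙ g ∙ h`.
      ... | inj₁ comm = contradiction
        (commutes∧squares⇒involution (sym (commutes-cancelˡ (sym comm) commutes-refl)) (squares mg mh))
        (moved⇒not-involution gh-moved)
      ... | inj₂ e = between (h ⁻¹ ∙ g ⁻¹) ε
        (solve 2 (λ g h → g ⊕ h ⊜ ⊖ h ⊕ ⊖ g ⊕ (g ⊕ h ⊕ (g ⊕ h) ⊕ 𝟏)) refl g h)
        (solve 2 (λ g h → ⊖ h ⊕ ⊖ g ⊕ (g ⊕ g ⊕ 𝟏) ⊜ ⊖ h ⊕ g) refl g h) (sym e)

    module MovedPair {i j : Carrier} (mi : MovedLetter i) (mj : MovedLetter j)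
                     (k-moved : Moved (i ∙ j)) where

      private
        li = proj₁ mi
        lj = proj₁ mj

      i-inverts-j : Inverts i j
      i-inverts-j = proj₁ (inverting-moved-pair mi mj k-moved)

      j-inverts-i : Inverts j i
      j-inverts-i = proj₂ (inverting-moved-pair mi mj k-moved)

      k²≈j² : (i ∙ j) ∙ (i ∙ j) ≈ j ∙ j
      k²≈j² = inverts⇒product-square j-inverts-i

      fixed-involution : ∀ {t} → FixedLetter t → t ∙ t ≈ ε
      fixed-involution ft = commutes∧inverts⇒involution
        (inverts-∙ˡ (letter-inverts-letter mi ft) (letter-inverts-letter mj ft))
        (product-inverts-letter li lj k-moved ft)

      -- If `g ∙ i` is fixed, `i` and `j` invert it, so `i ∙ j` commutes with it. This commutation
      -- turns `(i ∙ j) ⁻¹ ∙ (g ∙ i)`, of length 4 as written, into `g ∙ j`. The two products can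
      -- therefore be compared after all: `g ∙ i` is also inverted, hence an involution.
      noncommuting⇒moved : ∀ {g} → MovedLetter g → ¬ Commutes g i → Moved (g ∙ i)
      noncommuting⇒moved {g} mg@(lg , _) g∦i with product-status lg li
      ... | inj₁ m = m
      ... | inj₂ f = contradiction
        (squares∧involution⇒commutes (squares mg mi)
          (commutes∧inverts⇒involution k-commutes (moved-inverts-fixed
            (short-resp gj≈ (short-≤ (s≤s (s≤s z≤n)) (short₂ lg lj))) k-moved f)))
        g∦i
        where
        k-commutes : Commutes (i ∙ j) (g ∙ i)
        k-commutes = inverts-∙ˡ (letter-inverts-product mi lg li f) (letter-inverts-product mj lg li f)

        gj≈ : g ∙ j ≈ (i ∙ j) ⁻¹ ∙ (g ∙ i)
        gj≈ = begin
          g ∙ j                    ≈⟨ solve 3 (λ g i j → g ⊕ j ⊜ g ⊕ (j ⊕ i ⊕ ⊖ i)) refl g i j ⟩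
          g ∙ (j ∙ i ∙ i ⁻¹)       ≈⟨ ∙-congˡ (∙-congʳ (inverts-flip i-inverts-j)) ⟨
          g ∙ (i ∙ j ⁻¹ ∙ i ⁻¹)    ≈⟨ solve 3 (λ g i j → g ⊕ (i ⊕ ⊖ j ⊕ ⊖ i) ⊜ g ⊕ i ⊕ ⊖ (i ⊕ j)) refl g i j ⟩
          g ∙ i ∙ (i ∙ j) ⁻¹       ≈⟨ commutes-⁻¹ʳ (sym k-commutes) ⟩
          (i ∙ j) ⁻¹ ∙ (g ∙ i)     ∎

      moved-split : ∀ {g} → MovedLetter g → Commutes g i ⊎ (Inverts g i × Inverts i g)
      moved-split {g} mg with em {P = Commutes g i}
      ... | yes comm = inj₁ comm
      ... | no g∦i   = inj₂ (inverting-moved-pair mg mi (noncommuting⇒moved mg g∦i))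

      inverts⇒∦ : ∀ {g} → Inverts g i → ¬ Commutes g i
      inverts⇒∦ p q = moved⇒not-involution (proj₂ mi) (commutes∧inverts⇒involution q p)

      inverted : ∀ {g} → MovedLetter g → Inverts g i → Inverts i g
      inverted mg p = squares-inverse⇒inverts (squares mg mi) p

      inverting⇒moved : ∀ {g} → Letter g → Inverts g i → MovedLetter g
      inverting⇒moved lg p with letter-status lg
      ... | inj₁ mg = mg
      ... | inj₂ fg = contradiction
        (sym (inverts∧involution⇒commutes (letter-inverts-letter mi fg) (fixed-involution fg)))
        (inverts⇒∦ p)

      -- If `g ∙ h` is fixed, conjugation by `i` inverts it while it fixes `g` and inverts `h`; so
      -- `g ∙ h ⁻¹` equals `h ⁻¹ ∙ g ⁻¹`.
      moved-mixed : ∀ {g h} → MovedLetter g → MovedLetter h → Commutes g i → Inverts h i → Inverts h g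
      moved-mixed {g} {h} mg@(lg , _) mh@(lh , _) p q with product-status lg lh
      ... | inj₁ m = proj₂ (inverting-moved-pair mg mh m)
      ... | inj₂ f = begin
        h ∙ g                                ≈⟨ solve 3 (λ g h i → h ⊕ g ⊜ h ⊕ (g ⊕ (⊖ h ⊕ i)) ⊕ ⊖ i ⊕ h) refl g h i ⟩
        h ∙ (g ∙ (h ⁻¹ ∙ i)) ∙ i ⁻¹ ∙ h      ≈⟨ ∙-congʳ (∙-congʳ (∙-congˡ (∙-congˡ (inverted mh q)))) ⟨
        h ∙ (g ∙ (i ∙ h)) ∙ i ⁻¹ ∙ h         ≈⟨ ∙-congʳ (∙-congʳ (∙-congˡ (assoc _ _ _))) ⟨
        h ∙ (g ∙ i ∙ h) ∙ i ⁻¹ ∙ h           ≈⟨ ∙-congʳ (∙-congʳ (∙-congˡ (∙-congʳ p))) ⟩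
        h ∙ (i ∙ g ∙ h) ∙ i ⁻¹ ∙ h           ≈⟨ ∙-congʳ (∙-congʳ (∙-congˡ (assoc _ _ _))) ⟩
        h ∙ (i ∙ (g ∙ h)) ∙ i ⁻¹ ∙ h         ≈⟨ ∙-congʳ (∙-congʳ (∙-congˡ (letter-inverts-product mi lg lh f))) ⟩
        h ∙ ((g ∙ h) ⁻¹ ∙ i) ∙ i ⁻¹ ∙ h      ≈⟨ solve 3 (λ g h i → h ⊕ (⊖ (g ⊕ h) ⊕ i) ⊕ ⊖ i ⊕ h ⊜ ⊖ g ⊕ h) refl g h i ⟩
        g ⁻¹ ∙ h                             ∎

      -- If g h is moved, it inverts the fixed involution g d, hence commutes with it.
      commute-via : ∀ {g h d} → MovedLetter g → MovedLetter h → Short 2 d →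
                    Commutes d g → Commutes d h → (g ∙ g) ∙ (d ∙ d) ≈ ε →
                    Moved (g ∙ h) → Commutes g h
      commute-via {g} {h} {d} (lg , _) (lh , _) sd dg dh g²d²≈ε m
        with status (short-∙ (short₁ lg) sd)
      ... | inj₁ m′ = contradiction (commutes∧squares⇒involution (sym dg) g²d²≈ε) (moved⇒not-involution m′)
      ... | inj₂ f  = commutes-common-factor dg dh
        (inverts∧involution⇒commutes
          (moved-inverts-fixed
            (short-resp (solve 3 (λ g h d → ⊖ h ⊕ d ⊜ ⊖ (g ⊕ h) ⊕ (g ⊕ d)) refl g h d)
              (short-∙ (short-⁻¹ (short₁ lh)) sd)) m f)
          (commutes∧squares⇒involution (sym dg) g²d²≈ε))

      -- The letter `i` also inverts `g ∙ h`, which is thus an involution; by `squares`, its factors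
      -- commute.
      fixed-product-commutes : ∀ {g h} → MovedLetter g → MovedLetter h → Commutes (g ∙ h) i →
                               Fixed (g ∙ h) → Commutes g h
      fixed-product-commutes mg@(lg , _) mh@(lh , _) p f =
        squares∧involution⇒commutes (squares mg mh)
          (commutes∧inverts⇒involution (sym p) (letter-inverts-product mi lg lh f))

      moved-commuting : ∀ {g h} → MovedLetter g → MovedLetter h → Commutes g i → Commutes h i →
                        Commutes g h
      moved-commuting mg@(lg , _) mh@(lh , _) p q with product-status lg lh
      ... | inj₁ m = commute-via mg mh (short-≤ (s≤s z≤n) (short₁ li)) (sym p) (sym q) (squares mg mi) m
      ... | inj₂ f = fixed-product-commutes mg mh (commutes-∙ˡ p q) f

    module MovedPairDicyclic
      (fixed-commute : ∀ {t u} → FixedLetter t → FixedLetter u → Commutes t u)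
      {i j : Carrier} (mi : MovedLetter i) (mj : MovedLetter j) (k-moved : Moved (i ∙ j)) where

      module I = MovedPair mi mj k-moved
      -- The situation is symmetric in `i` and `j`; the relation required by `swap` depends on how
      -- letters act on `j`.
      module J = MovedPair mj mi (I.noncommuting⇒moved mj (I.inverts⇒∦ I.j-inverts-i))

      private
        li = proj₁ mi
        lj = proj₁ mj

      fixed-central : ∀ {t g} → FixedLetter t → Letter g → Commutes t g
      fixed-central ft lg with letter-status lg
      ... | inj₁ mg = sym (inverts∧involution⇒commutes (letter-inverts-letter mg ft) (I.fixed-involution ft))
      ... | inj₂ fg = fixed-commute ft fg

      split-i : ∀ {g} → Letter g → Commutes g i ⊎ Inverts g i
      split-i lg with letter-status lg
      ... | inj₂ fg = inj₁ (fixed-central fg li)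
      ... | inj₁ mg with I.moved-split mg
      ...   | inj₁ p       = inj₁ p
      ...   | inj₂ (p , _) = inj₂ p

      commuting : ∀ {g h} → Letter g → Letter h → Commutes g i → Commutes h i → Commutes g h
      commuting lg lh p q with letter-status lg | letter-status lh
      ... | inj₁ mg | inj₁ mh = I.moved-commuting mg mh p q
      ... | inj₁ mg | inj₂ fh = sym (fixed-central fh lg)
      ... | inj₂ fg | _       = fixed-central fg lh

      mixed : ∀ {g h} → Letter g → Letter h → Commutes g i → Inverts h i → Inverts h g
      mixed lg lh p q with letter-status lg
      ... | inj₁ mg = I.moved-mixed mg (I.inverting⇒moved lh q) p q
      ... | inj₂ fg = commutes∧involution⇒inverts (sym (fixed-central fg lh)) (I.fixed-involution fg)

      swap-moved : ∀ {g h} → MovedLetter g → MovedLetter h → Inverts g i → Inverts h i →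
                   g ∙ j ∙ h ≈ h ∙ j ∙ g
      swap-moved {g} {h} mg mh p q with J.moved-split mg | J.moved-split mh
      ... | inj₁ gj | inj₁ hj = swap-commuting gj hj (J.moved-commuting mg mh gj hj)
      ... | inj₂ (g-inv , _) | inj₁ hj =
        swap-mixed g-inv hj (J.moved-mixed mh mg hj g-inv) (squares mh mj)
      ... | inj₁ gj | inj₂ (h-inv , _) = sym
        (swap-mixed h-inv gj (J.moved-mixed mg mh gj h-inv) (squares mg mj))
      ... | inj₂ (g-inv , j-inv-g) | inj₂ (h-inv , j-inv-h) = swap-inverting g-inv h-inv gh
        where
        gh : Commutes g h
        gh with product-status (proj₁ mg) (proj₁ mh)
        ... | inj₂ f = I.fixed-product-commutes mg mh (inverts-∙ˡ p q) f
        -- Both `g` and `h` are inverted by `i` and by `j`, so `i ∙ j` commutes with both; its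
        -- square is `j²`.
        ... | inj₁ m = I.commute-via mg mh (short₂ li lj)
          (inverts-∙ˡ (I.inverted mg p) j-inv-g) (inverts-∙ˡ (I.inverted mh q) j-inv-h)
          (trans (∙-congˡ I.k²≈j²) (squares mg mj)) m

      open QuaternionicPair lj I.j-inverts-i (moved⇒not-involution (proj₂ mj)) split-i
        (λ lg p → squares (I.inverting⇒moved lg p) mj) commuting mixed
        (λ lg lh p q → swap-moved (I.inverting⇒moved lg p) (I.inverting⇒moved lh q) p q)
        public using (generalizedDicyclic)

    -- A is generated by the fixed letters and the products of two moved letters.
    module FixedProducts
      (fixed-commute  : ∀ {t u} → FixedLetter t → FixedLetter u → Commutes t u)
      (product-fixed  : ∀ {s u} → MovedLetter s → MovedLetter u → Fixed (s ∙ u))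
      where

      P : Carrier → Set (c ⊔ ℓ)
      P a = FixedLetter a ⊎ (∃[ s ] ∃[ u ] MovedLetter s × MovedLetter u × s ∙ u ≈ a)

      moved-inverts : ∀ {g a} → MovedLetter g → P a → Inverts g a
      moved-inverts mg (inj₁ fa) = letter-inverts-letter mg fa
      moved-inverts mg (inj₂ (s , u , ms , mu , e)) = inverts-respʳ e
        (letter-inverts-product mg (proj₁ ms) (proj₁ mu) (product-fixed ms mu))

      -- Each moved letter inverts all of `P`, so a product of two of them commutes with all of `P`.
      P-commutes : ∀ {a b} → P a → P b → Commutes a b
      P-commutes (inj₁ fa) (inj₁ fb) = fixed-commute fa fb
      P-commutes (inj₂ (s , u , ms , mu , e)) b =
        commutes-respˡ e (inverts-∙ˡ (moved-inverts ms b) (moved-inverts mu b))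
      P-commutes a@(inj₁ _) b@(inj₂ _) = sym (P-commutes b a)

      P-split : ∀ {g} → Letter g → P g ⊎ P (g ∙ s₀)
      P-split lg with letter-status lg
      ... | inj₁ mg = inj₂ (inj₂ (_ , s₀ , mg , m₀ , refl))
      ... | inj₂ fg = inj₁ (inj₁ fg)

      open DicyclicCriterion P s₀ nonAbelian P-commutes (moved-inverts m₀)
        (inj₂ (s₀ , s₀ , m₀ , m₀ , refl)) (moved⇒not-involution (proj₂ m₀)) P-split
        public using (generalizedDicyclic)

    generalizedDicyclic : IsGeneralizedDicyclic G
    generalizedDicyclic
      with em {P = ∃[ i ] ∃[ j ] FixedLetter i × FixedLetter j × Moved (i ∙ j)}
         | em {P = ∃[ i ] ∃[ j ] MovedLetter i × MovedLetter j × Moved (i ∙ j)}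
    ... | yes (i , j , fi , fj , m) | _ = FixedPair.generalizedDicyclic fi fj m
    ... | no no-fixed | moved = conclude moved
      where
      fixed-commute : ∀ {t u} → FixedLetter t → FixedLetter u → Commutes t u
      fixed-commute ft fu with fixed-pair ft fu
      ... | inj₁ comm    = comm
      ... | inj₂ (m , _) = contradiction (_ , _ , ft , fu , m) no-fixed

      conclude : _ → _
      conclude (yes (i , j , mi , mj , m)) = MovedPairDicyclic.generalizedDicyclic fixed-commute mi mj m
      conclude (no no-moved) = FixedProducts.generalizedDicyclic fixed-commute
        λ {s} {u} ms mu → [ (λ m → contradiction (s , u , ms , mu , m) no-moved) , (λ f → f) ]′
          (product-status (proj₁ ms) (proj₁ mu))

-- Rigidity of non-exceptional groups.

module _ (em : ∀ {a} → ExcludedMiddle a) {c ℓ : Level} (G : Group c ℓ) where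

  open Group G
  open GroupSolver G using (solve; _⊜_; _⊕_; ⊖_; 𝟏)
  open CommutesInverts G
  open Algebra.Properties.Group G using (\\-leftDividesˡ; \\-leftDividesʳ)

  NonExceptional : Set (Level.suc (c ⊔ ℓ))
  NonExceptional = ¬ IsGeneralizedDicyclic G
                 × ¬ (IsAbelian G × (∃[ x ] OrderGreaterThan G x 2))

  module _ (S : Subset G (c ⊔ ℓ)) (generating : IsGeneratingSet G S) where

    open Words G S
    open Induction generating

    module NoMovedLetters
      (nonExceptional : NonExceptional)
      (ψ : ∀ g → Short 3 g → Carrier) (ψ-coloured : LocallyColoured ψ)
      where

      open LocalAutomorphism em G S generating ψ ψ-coloured

      letter-fixed : ∀ {g} → Letter g → ∀ s → ψ g s ≈ g
      letter-fixed {g} l s with em {P = ψ g s ≈ g} | em {P = IsAbelian G}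
      ... | yes fixed | _         = fixed
      ... | no moved  | no ¬abel  = contradiction
        (NonAbelian.generalizedDicyclic (l , s , moved) ¬abel) (proj₁ nonExceptional)
      ... | no moved  | yes abel  = contradiction (abel , g , order>2) (proj₂ nonExceptional)
        where
        g²≉ε = moved⇒not-involution (s , moved)
        order>2 : OrderGreaterThan G g 2
        order>2 1 _ _ e = g²≉ε (trans (∙-cong g≈ε g≈ε) (identityˡ ε))
          where g≈ε = trans (sym (identityʳ g)) e
        order>2 2 _ _ e = g²≉ε (trans (∙-congˡ (sym (identityʳ g))) e)
        order>2 (suc (suc (suc _))) _ (s≤s (s≤s ()))

    -- A general colour set `T` lets one argument cover both `S ^≤ 3` and the set of all non-trivial
    -- elements.
    module _ {p} (T : Subset G p)
             (short⊆T : ∀ {g} → ¬ (g ≈ ε) → Short 3 g → Subset.Member (_± G T) g) where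

      module _ (nonExceptional : NonExceptional) (α : ColourAut G T) where

        open ColourAut α
        private φ-cong = Inverse.to-cong perm

        -- Left translations preserve colours, so conjugating `φ` by translation by `h` gives a
        -- local map that fixes `ε`, to which the result on letters applies.
        fixed-neighbour : ∀ {h s} → φ h ≈ h → Letter s → φ (h ∙ s) ≈ h ∙ s
        fixed-neighbour {h} {s} φh≈h l = trans (sym (\\-leftDividesˡ h _)) (∙-congˡ
          (letter-fixed l (short-≤ (s≤s z≤n) (short-letter l))))
          where
          ψ : ∀ g → Short 3 g → Carrier
          ψ g _ = h ⁻¹ ∙ φ (h ∙ g)

          ψ-ε : ∀ s → ψ ε s ≈ ε
          ψ-ε _ = trans (∙-congˡ (trans (φ-cong (identityʳ h)) φh≈h)) (inverseˡ h)

          hy≈ : ∀ x y → h ∙ y ≈ h ∙ x ∙ (x ⁻¹ ∙ y)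
          hy≈ = solve 3 (λ h x y → h ⊕ y ⊜ h ⊕ x ⊕ (⊖ x ⊕ y)) refl h

          ψ-step : ∀ {x y} (sx : Short 3 x) (sy : Short 3 y) → Short 3 (x ⁻¹ ∙ y) →
                   ψ y sy ≈ ψ x sx ∙ (x ⁻¹ ∙ y) ⊎ ψ y sy ≈ ψ x sx ∙ (x ⁻¹ ∙ y) ⁻¹
          ψ-step {x} {y} _ _ d with em {P = x ⁻¹ ∙ y ≈ ε}
          -- Colours are supplied for non-trivial elements only, so a trivial quotient is settled by
          -- congruence.
          ... | yes e = inj₁ (trans (∙-congˡ (φ-cong (trans (hy≈ x y) (trans (∙-congˡ e) (identityʳ _)))))
                              (sym (trans (∙-congˡ e) (identityʳ _))))
          ... | no ≉ε with colour-preserving (h ∙ x) (x ⁻¹ ∙ y) (short⊆T ≉ε d)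
          ...   | inj₁ e = inj₁ (trans (∙-congˡ (trans (φ-cong (hy≈ x y)) e)) (sym (assoc _ _ _)))
          ...   | inj₂ e = inj₂ (trans (∙-congˡ (trans (φ-cong (hy≈ x y)) e)) (sym (assoc _ _ _)))

          ψ-coloured : LocallyColoured ψ
          ψ-coloured = record { ψ-ε = ψ-ε ; ψ-step = ψ-step }

          open NoMovedLetters nonExceptional ψ ψ-coloured

        -- The induction takes letters off the left end of `u`, so the base point `h` has to vary.
        fixed-translate : ∀ u h → φ h ≈ h → φ (h ∙ u) ≈ h ∙ u
        fixed-translate = word-induction (λ u → ∀ h → φ h ≈ h → φ (h ∙ u) ≈ h ∙ u)
          (λ e q h f → trans (φ-cong (∙-congˡ (sym e))) (trans (q h f) (∙-congˡ e)))
          (λ h f → trans (φ-cong (identityʳ h)) (trans f (sym (identityʳ h))))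
          (λ {g} {u} l q h f → trans (φ-cong (sym (assoc h g u)))
            (trans (q (h ∙ g) (fixed-neighbour f l)) (assoc h g u)))

      leftTranslation : Carrier → ColourAut G T
      leftTranslation k = record
        { perm = record
          { to        = k ∙_
          ; from      = k ⁻¹ ∙_
          ; to-cong   = ∙-congˡ
          ; from-cong = ∙-congˡ
          ; inverse   = (λ e → trans (∙-congˡ e) (\\-leftDividesˡ k _))
                      , (λ e → trans (∙-congˡ e) (\\-leftDividesʳ k _))
          }
        ; colour-preserving = λ g s _ → inj₁ (sym (assoc k g s))
        }

      orientationRigid : NonExceptional → OrientationRigid G T
      orientationRigid nonExceptional = record
        { free = λ α g f h →
            trans (Inverse.to-cong (ColourAut.perm α) (sym (\\-leftDividesˡ g h)))
              (trans (fixed-translate nonExceptional α (g ⁻¹ ∙ h) g f) (\\-leftDividesˡ g h))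
        ; transitive = λ g h → leftTranslation (h ∙ g ⁻¹)
            , solve 2 (λ g h → h ⊕ ⊖ g ⊕ g ⊜ h) refl g h
        }

    T₃ : Subset G (c ⊔ ℓ)
    T₃ = _^≤_ G S 3

    short⇒vertex : ∀ {g} → Short 3 g → Subset.Member (Graph.Vertices (ball G T₃)) g
    short⇒vertex {g} s with em {P = g ≈ ε}
    ... | yes e = tt , inj₁ e
    ... | no ≉ε = tt , inj₂ (inj₁ (≉ε , s))

    stronglyRigid : NonExceptional → StronglyOrientationRigid G S T₃
    stronglyRigid nonExceptional α φε≈ε v v∈S v∈ = fixes v∈S
      where
      open SubgraphColourAut α
      open Graph (ball G T₃) using (Vertices)

      φ-cong : ∀ {g h} (g∈ : Subset.Member Vertices g) (h∈ : Subset.Member Vertices h) →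
               g ≈ h → φ g g∈ ≈ φ h h∈
      φ-cong g∈ h∈ = Inverse.to-cong perm {_ , g∈} {_ , h∈}

      ψ : ∀ g → Short 3 g → Carrier
      ψ g s = φ g (short⇒vertex s)

      ψ-step : ∀ {x y} (sx : Short 3 x) (sy : Short 3 y) → Short 3 (x ⁻¹ ∙ y) →
               ψ y sy ≈ ψ x sx ∙ (x ⁻¹ ∙ y) ⊎ ψ y sy ≈ ψ x sx ∙ (x ⁻¹ ∙ y) ⁻¹
      ψ-step {x} {y} sx sy d with em {P = x ⁻¹ ∙ y ≈ ε}
      ... | yes e = inj₁ (trans
        (φ-cong (short⇒vertex sy) (short⇒vertex sx)
          (trans (sym (\\-leftDividesˡ x y)) (trans (∙-congˡ e) (identityʳ x))))
        (sym (trans (∙-congˡ e) (identityʳ _))))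
      ... | no ≉ε = [ (λ e → inj₁ (trans y≈ e)) , (λ e → inj₂ (trans y≈ e)) ]′
        (colour-preserving x (x ⁻¹ ∙ y) t∈ (short⇒vertex sx , xt∈ ,
          Subset.resp (_± G T₃) (sym (\\-leftDividesʳ x _)) t∈))
        where
        t∈ : Subset.Member (_± G T₃) (x ⁻¹ ∙ y)
        t∈ = inj₁ (≉ε , d)
        xt∈ = Subset.resp Vertices (sym (\\-leftDividesˡ x y)) (short⇒vertex sy)
        y≈ = φ-cong (short⇒vertex sy) xt∈ (sym (\\-leftDividesˡ x y))

      ψ-coloured : LocallyColoured ψ
      ψ-coloured = record { ψ-ε = λ s → φε≈ε (short⇒vertex s) ; ψ-step = ψ-step }

      open NoMovedLetters nonExceptional ψ ψ-coloured

      fixes : Subset.Member (Graph.Vertices (ball G S)) v → φ v v∈ ≈ v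
      fixes (_ , inj₁ v≈ε) = trans (φ-cong v∈ (tt , inj₁ refl) v≈ε) (trans (φε≈ε _) (sym v≈ε))
      fixes (_ , inj₂ l)   = trans (φ-cong v∈ (short⇒vertex s) refl) (letter-fixed l s)
        where s = short-≤ (s≤s z≤n) (short-letter l)

  -- A colour automorphism for the largest colour set, hence for every colour set.
  record Twist : Set (c ⊔ ℓ) where
    field
      τ          : Carrier → Carrier
      τ-cong     : ∀ {g h} → g ≈ h → τ g ≈ τ h
      involutive : ∀ g → τ (τ g) ≈ g
      τ-ε        : τ ε ≈ ε
      coloured   : ∀ g s → τ (g ∙ s) ≈ τ g ∙ s ⊎ τ (g ∙ s) ≈ τ g ∙ s ⁻¹
      fixed-∙    : ∀ {g h} → τ g ≈ g → τ h ≈ h → τ (g ∙ h) ≈ g ∙ h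
      x          : Carrier
      x-moved    : ¬ (τ x ≈ x)

  -- Twists contradict rigidity.

  module _ (twist : Twist) where

    open Twist twist

    ¬orientationRigid : ∀ {p} (T : Subset G p) → ¬ OrientationRigid G T
    ¬orientationRigid T rigid = x-moved (OrientationRigid.free rigid α ε τ-ε x)
      where
      α : ColourAut G T
      α = record
        { perm = record
          { to = τ ; from = τ ; to-cong = τ-cong ; from-cong = τ-cong
          ; inverse = (λ e → trans (τ-cong e) (involutive _)) , (λ e → trans (τ-cong e) (involutive _))
          }
        ; colour-preserving = λ g s _ → coloured g s
        }

    -- Strong rigidity only makes `τ` fix the letters; `fixed-∙` extends this to all of `G`, against
    -- `x-moved`. The twist acts on the ball because `τ g` is `g` or `g ⁻¹`.
    ¬stronglyRigid : (S : Subset G (c ⊔ ℓ)) → IsGeneratingSet G S →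
                     ¬ StronglyOrientationRigid G S (_^≤_ G S 3)
    ¬stronglyRigid S generating rigid = x-moved (τ-trivial x)
      where
      open Words G S
      open Induction generating
      T = _^≤_ G S 3
      open Graph (ball G T) using (Vertices)

      τ≈ : ∀ g → τ g ≈ g ⊎ τ g ≈ g ⁻¹
      τ≈ g with coloured ε g
      ... | inj₁ e = inj₁ (trans (τ-cong (sym (identityˡ g))) (trans e (trans (∙-congʳ τ-ε) (identityˡ _))))
      ... | inj₂ e = inj₂ (trans (τ-cong (sym (identityˡ g))) (trans e (trans (∙-congʳ τ-ε) (identityˡ _))))

      τ-vertex : ∀ {g} → Subset.Member Vertices g → Subset.Member Vertices (τ g)
      τ-vertex (_ , inj₁ e) = tt , inj₁ (trans (τ-cong e) τ-ε)
      τ-vertex {g} (_ , inj₂ t) with τ≈ g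
      ... | inj₁ e = tt , inj₂ (Subset.resp (_± G T) (sym e) t)
      ... | inj₂ e = tt , inj₂ (Subset.resp (_± G T) (sym e) (Words.letter-⁻¹ G T t))

      α : SubgraphColourAut G T (ball G T)
      α = record
        { perm = record
          { to = λ (g , g∈) → τ g , τ-vertex g∈ ; from = λ (g , g∈) → τ g , τ-vertex g∈
          ; to-cong = τ-cong ; from-cong = τ-cong
          ; inverse = (λ e → trans (τ-cong e) (involutive _)) , (λ e → trans (τ-cong e) (involutive _))
          }
        ; colour-preserving = λ g s _ _ → coloured g s
        }

      τ-letter : ∀ {s} → Letter s → τ s ≈ s
      τ-letter l = rigid α (λ _ → τ-ε) _ (tt , inj₂ l)
        (short⇒vertex S generating (short-≤ (s≤s z≤n) (short-letter l)))

      τ-trivial : ∀ g → τ g ≈ g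
      τ-trivial = word-induction (λ g → τ g ≈ g)
        (λ e f → trans (τ-cong (sym e)) (trans f e)) τ-ε (λ l f → fixed-∙ (τ-letter l) f)

  -- Twists of the exceptional groups.

  abelianTwist : IsAbelian G → (∃[ x ] OrderGreaterThan G x 2) → Twist
  abelianTwist comm (x , order>2) = record
    { τ          = _⁻¹
    ; τ-cong     = ⁻¹-cong
    ; involutive = solve 1 (λ g → ⊖ ⊖ g ⊜ g) refl
    ; τ-ε        = solve 0 (⊖ 𝟏 ⊜ 𝟏) refl
    ; coloured   = λ g s → inj₂ (∙-⁻¹ g s)
    ; fixed-∙    = λ {g} {h} p q → trans (∙-⁻¹ g h) (∙-cong p q)
    ; x          = x
    ; x-moved    = λ e → order>2 2 (s≤s z≤n) ℕ.≤-refl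
        (trans (∙-congˡ (identityʳ x)) (⁻¹≈⇒involution (sym e)))
    }
    where
    ∙-⁻¹ : ∀ g h → (g ∙ h) ⁻¹ ≈ g ⁻¹ ∙ h ⁻¹
    ∙-⁻¹ g h = trans (⁻¹-cong (comm g h)) (solve 2 (λ g h → ⊖ (h ⊕ g) ⊜ ⊖ g ⊕ ⊖ h) refl g h)

  module _ (dicyclic : IsGeneralizedDicyclic G) where

    open IsGeneralizedDicyclic dicyclic
    open IsNormalSubgroup A-normal
    open IsSubgroup isSubgroup
    open Subset A renaming (Member to _∈A; resp to A-resp)

    private
      two-values : ∀ {k l m : Fin 2} → k ≢ m → l ≢ m → k ≡ l
      two-values {Fin.zero}         {Fin.zero}         {_}                _   _   = ≡.refl
      two-values {Fin.suc Fin.zero} {Fin.suc Fin.zero} {_}                _   _   = ≡.refl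
      two-values {Fin.zero}         {Fin.suc Fin.zero} {Fin.zero}         k≢m _   = contradiction ≡.refl k≢m
      two-values {Fin.zero}         {Fin.suc Fin.zero} {Fin.suc Fin.zero} _   l≢m = contradiction ≡.refl l≢m
      two-values {Fin.suc Fin.zero} {Fin.zero}         {Fin.zero}         _   l≢m = contradiction ≡.refl l≢m
      two-values {Fin.suc Fin.zero} {Fin.zero}         {Fin.suc Fin.zero} k≢m _   = contradiction ≡.refl k≢m

      index : Carrier → Fin 2
      index g = proj₁ (proj₂ A-index g)

      same-index : ∀ {g h} → index g ≡ index h → (g ⁻¹ ∙ h) ∈A
      same-index {g} {h} e with proj₂ A-index g | proj₂ A-index h
      same-index {g} {h} ≡.refl | k , p , _ | .k , q , _ = A-resp
        (solve 3 (λ r g h → ⊖ (⊖ r ⊕ g) ⊕ (⊖ r ⊕ h) ⊜ ⊖ g ⊕ h) refl (proj₁ A-index k) g h)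
        (∙-closed (⁻¹-closed p) q)

      outside-quotient : ∀ {g h} → ¬ (g ∈A) → ¬ (h ∈A) → (g ⁻¹ ∙ h) ∈A
      outside-quotient g∉ h∉ = same-index (two-values (other-coset g∉) (other-coset h∉))
        where
        other-coset : ∀ {g} → ¬ (g ∈A) → index g ≢ index ε
        other-coset {g} g∉ e = g∉ (A-resp (solve 1 (λ g → ⊖ (⊖ g ⊕ 𝟏) ⊜ g) refl g)
          (⁻¹-closed (same-index e)))

      outside-product : ∀ {g h} → ¬ (g ∈A) → ¬ (h ∈A) → (g ∙ h) ∈A
      outside-product {g} {h} g∉ h∉ with em {P = (g ∙ h) ∈A}
      ... | yes p = p
      ... | no  p = contradiction (A-resp (\\-leftDividesʳ g h) (outside-quotient g∉ p)) h∉

      outside-inside : ∀ {g a} → ¬ (g ∈A) → a ∈A → ¬ ((g ∙ a) ∈A)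
      outside-inside {g} {a} g∉ a∈ p = g∉ (A-resp (solve 2 (λ g a → g ⊕ a ⊕ ⊖ a ⊜ g) refl g a)
        (∙-closed p (⁻¹-closed a∈)))

      inside-outside : ∀ {g a} → a ∈A → ¬ (g ∈A) → ¬ ((a ∙ g) ∈A)
      inside-outside {g} {a} a∈ g∉ p = g∉ (A-resp (\\-leftDividesʳ a g) (∙-closed (⁻¹-closed a∈) p))

      x-inverts : ∀ {a} → a ∈A → Inverts x a
      x-inverts {a} a∈ = trans (solve 2 (λ x a → x ⊕ a ⊜ x ⊕ a ⊕ ⊖ x ⊕ x) refl x a) (∙-congʳ (inverts a∈))

      outside≈ : ∀ g → x ∙ (x ⁻¹ ∙ g) ≈ g
      outside≈ = \\-leftDividesˡ x

      -- Such a `g` is `x` times an element of `A`, and the latter commutes with `a`.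
      outside-inverts : ∀ {g a} → ¬ (g ∈A) → a ∈A → Inverts g a
      outside-inverts {g} g∉ a∈ = trans (∙-congʳ (sym (outside≈ g)))
        (trans (inverts∧commutes-∙ˡ (x-inverts a∈) (A-abelian (outside-quotient x∉A g∉) a∈))
          (∙-congˡ (outside≈ g)))

      -- With `g` written as `x ∙ b`, moving the second `x` past `b` inverts `b`, which then
      -- cancels.
      outside-square : ∀ {g} → ¬ (g ∈A) → g ∙ g ≈ x ∙ x
      outside-square {g} g∉ = trans (∙-cong (sym (outside≈ g)) (sym (outside≈ g)))
        (between x (x ⁻¹ ∙ g)
          (solve 2 (λ x b → x ⊕ b ⊕ (x ⊕ b) ⊜ x ⊕ (b ⊕ x ⊕ b)) refl x (x ⁻¹ ∙ g))
          (solve 2 (λ x b → x ⊕ (x ⊕ ⊖ b ⊕ b) ⊜ x ⊕ x) refl x (x ⁻¹ ∙ g))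
          (sym (inverts-flip (x-inverts (outside-quotient x∉A g∉)))))

      x⁴≈ε : (x ∙ x) ∙ (x ∙ x) ≈ ε
      x⁴≈ε = trans (solve 1 (λ x → x ⊕ x ⊕ (x ⊕ x) ⊜ x ⊕ (x ⊕ (x ⊕ (x ⊕ 𝟏)))) refl x)
        (proj₁ (proj₂ x-order))

      x²≉ε : ¬ (x ∙ x ≈ ε)
      x²≉ε e = proj₂ (proj₂ x-order) 2 (s≤s z≤n) (s≤s (s≤s (s≤s z≤n)))
        (trans (∙-congˡ (identityʳ x)) e)

      τ : Carrier → Carrier
      τ g with em {P = g ∈A}
      ... | yes _ = g
      ... | no  _ = g ⁻¹

      τ-inside : ∀ {g} → g ∈A → τ g ≈ g
      τ-inside {g} g∈ with em {P = g ∈A}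
      ... | yes _  = refl
      ... | no  g∉ = contradiction g∈ g∉

      τ-outside : ∀ {g} → ¬ (g ∈A) → τ g ≈ g ⁻¹
      τ-outside {g} g∉ with em {P = g ∈A}
      ... | yes g∈ = contradiction g∈ g∉
      ... | no  _  = refl

      outside-⁻¹ : ∀ {g} → ¬ (g ∈A) → ¬ ((g ⁻¹) ∈A)
      outside-⁻¹ g∉ p = g∉ (A-resp (solve 1 (λ g → ⊖ ⊖ g ⊜ g) refl _) (⁻¹-closed p))

      τ-cong : ∀ {g h} → g ≈ h → τ g ≈ τ h
      τ-cong {g} e with em {P = g ∈A}
      ... | yes g∈ = trans e (sym (τ-inside (A-resp e g∈)))
      ... | no  g∉ = trans (⁻¹-cong e) (sym (τ-outside (g∉ ∘ A-resp (sym e))))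

      involutive : ∀ g → τ (τ g) ≈ g
      involutive g with em {P = g ∈A}
      ... | yes g∈ = τ-inside g∈
      ... | no  g∉ = trans (τ-outside (outside-⁻¹ g∉)) (solve 1 (λ g → ⊖ ⊖ g ⊜ g) refl g)

      -- Outside `A`, a fixed element would be an involution, but its square is `x²`.
      fixed⇒inside : ∀ {g} → τ g ≈ g → g ∈A
      fixed⇒inside {g} e with em {P = g ∈A}
      ... | yes g∈ = g∈
      ... | no  g∉ = contradiction (trans (sym (outside-square g∉)) (⁻¹≈⇒involution (sym e))) x²≉ε

      coloured : ∀ g s → τ (g ∙ s) ≈ τ g ∙ s ⊎ τ (g ∙ s) ≈ τ g ∙ s ⁻¹
      coloured g s with em {P = g ∈A} | em {P = s ∈A}
      ... | yes g∈ | yes s∈ = inj₁ (τ-inside (∙-closed g∈ s∈))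
      ... | yes g∈ | no  s∉ = inj₂ (trans (τ-outside (inside-outside g∈ s∉))
        (between ε ε
          (solve 2 (λ g s → ⊖ (g ⊕ s) ⊜ 𝟏 ⊕ (⊖ s ⊕ ⊖ g ⊕ 𝟏)) refl g s)
          (solve 2 (λ g s → 𝟏 ⊕ (g ⊕ ⊖ s ⊕ 𝟏) ⊜ g ⊕ ⊖ s) refl g s)
          (inverts-flip (outside-inverts (outside-⁻¹ s∉) g∈))))
      ... | no  g∉ | yes s∈ = inj₁ (trans (τ-outside (outside-inside g∉ s∈))
        (trans (solve 2 (λ g s → ⊖ (g ⊕ s) ⊜ ⊖ s ⊕ ⊖ g) refl g s)
          (sym (outside-inverts (outside-⁻¹ g∉) s∈))))
      -- The product lies in `A` and must equal `g ⁻¹ ∙ s ⁻¹`; it does because `g² ∙ s²` is `x⁴`.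
      ... | no  g∉ | no  s∉ = inj₂ (trans (τ-inside (outside-product g∉ s∉))
        (sym (squares⇒⁻¹⁻¹ (trans (∙-cong (outside-square g∉) (outside-square s∉)) x⁴≈ε))))

    dicyclicTwist : Twist
    dicyclicTwist = record
      { τ          = τ
      ; τ-cong     = τ-cong
      ; involutive = involutive
      ; τ-ε        = τ-inside ε-closed
      ; coloured   = coloured
      ; fixed-∙    = λ p q → τ-inside (∙-closed (fixed⇒inside p) (fixed⇒inside q))
      ; x          = x
      ; x-moved    = x∉A ∘ fixed⇒inside
      }

  twists⇒nonExceptional : ¬ Twist → NonExceptional
  twists⇒nonExceptional ¬twist =
    (λ dicyclic → ¬twist (dicyclicTwist dicyclic)) ,
    (λ (abelian , x) → ¬twist (abelianTwist abelian x))

  -- `nonTrivial` lives at level `ℓ`, the generating sets of the theorem at `c ⊔ ℓ`. This copy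
  -- witnesses the existential conditions and instantiates the universal ones.
  nonTrivialLifted : Subset G (c ⊔ ℓ)
  nonTrivialLifted = record
    { Member = λ g → Lift c (¬ (g ≈ ε))
    ; resp   = λ e (lift ≉ε) → lift (Subset.resp (nonTrivial G) e ≉ε)
    }

  nonTrivial-generates : IsGeneratingSet G nonTrivialLifted
  nonTrivial-generates = record
    { ε∉S       = λ (lift ≉ε) → ≉ε refl
    ; generates = λ g → spell g em
    }
    where
    spell : ∀ g → Dec (g ≈ ε) → _
    spell g (yes e) = [] , [] , e
    spell g (no ≉ε) = g ∷ [] , inj₁ (lift ≉ε) ∷ [] , sym (identityʳ g)

theorem6 : (∀ {a} → ExcludedMiddle a) →
  ∀ {c ℓ} (G : Group c ℓ) →
  let _^≤3 = λ (S : Subset G (c ⊔ ℓ)) → _^≤_ G S 3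
      C1  = ¬ IsGeneralizedDicyclic G
          × ¬ (IsAbelian G × (∃[ x ] OrderGreaterThan G x 2))
      C2  = OrientationRigidGroup G
      C3  = ∀ (S : Subset G (c ⊔ ℓ)) → IsGeneratingSet G S →
              OrientationRigid G (S ^≤3)
      C3′ = ∃[ S ] IsGeneratingSet G S × OrientationRigid G (S ^≤3)
      C4  = ∀ (S : Subset G (c ⊔ ℓ)) → IsGeneratingSet G S →
              StronglyOrientationRigid G S (S ^≤3)
      C4′ = ∃[ S ] IsGeneratingSet G S × StronglyOrientationRigid G S (S ^≤3)
  in (C1 ⇔ C2) × (C1 ⇔ C3) × (C1 ⇔ C3′) × (C1 ⇔ C4) × (C1 ⇔ C4′)
theorem6 em {c} {ℓ} G =
    mk⇔ (orientationRigid em G S₀ gen₀ (nonTrivial G) (λ ≉ε _ → inj₁ ≉ε))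
        (λ rigid → nonExceptional λ t → ¬orientationRigid em G t (nonTrivial G) rigid)
  , mk⇔ rigid₃ (λ rigid → nonExceptional λ t → ¬orientationRigid em G t _ (rigid S₀ gen₀))
  , mk⇔ (λ n → S₀ , gen₀ , rigid₃ n S₀ gen₀)
        (λ (S , _ , rigid) → nonExceptional λ t → ¬orientationRigid em G t _ rigid)
  , mk⇔ strong (λ rigid → nonExceptional λ t → ¬stronglyRigid em G t S₀ gen₀ (rigid S₀ gen₀))
  , mk⇔ (λ n → S₀ , gen₀ , strong n S₀ gen₀)
        (λ (S , gen , rigid) → nonExceptional λ t → ¬stronglyRigid em G t S gen rigid)
  where
  S₀             = nonTrivialLifted em G
  gen₀           = nonTrivial-generates em G
  nonExceptional = twists⇒nonExceptional em G

  rigid₃ : NonExceptional em G → ∀ (S : Subset G (c ⊔ ℓ)) → IsGeneratingSet G S →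
           OrientationRigid G (_^≤_ G S 3)
  rigid₃ n S gen = orientationRigid em G S gen _ (λ ≉ε s → inj₁ (≉ε , s)) n

  strong : NonExceptional em G → ∀ (S : Subset G (c ⊔ ℓ)) → IsGeneratingSet G S →
           StronglyOrientationRigid G S (_^≤_ G S 3)
  strong n S gen = stronglyRigid em G S gen n
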